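{- Let $T=\{t_1,\ldots,t_N\}$ be documents, each containing at most $L$ distinct words from a dictionary $\{w_1,\ldots,w_D\}$ ($D\ge 2$). For a word $w$ let $\#(w)$ be the number of documents containing $w$ and for words $x,y$ let $\#(x,y)$ be the number of documents containing both. Fix $\epsilon\in(0,1]$ and $p=2\log D$. Consider the MapReduce mapper that, for every document $t$ and every unordered pair of distinct words $(w_i,w_j)$ in $t$, independently emits the key-value pair $((w_i,w_j)\to 1)$ with probability $\min\!\left(1,\frac{p}{\epsilon}\frac{1}{\sqrt{\#(w_i)}\sqrt{\#(w_j)}}\right)$ (CosineSampleEmit). Then the expected total number of emitted pairs (the shuffle size) is at most $\frac{p}{\epsilon}LD=O(DL\log(D)/\epsilon)$, independently of $N$. Moreover, this is tight up to the factor $\log(D)/\epsilon$: whenever $L\ge 2$ divides $D$, there is an input of this form with at least $(D/L)\binom{L}{2}=\Omega(DL)$ pairs of words having cosine similarity $1\ge\epsilon$, so any algorithm that outputs all pairs with cosine similarity at least $\epsilon$ (in particular a shuffle of CosineSampleEmit from which these are computed) must produce $\Omega(DL)$ output in the worst case.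
   Context: Cosine similarity of words $x,y$ is $\frac{\#(x,y)}{\sqrt{\#(x)}\sqrt{\#(y)}}$. The shuffle size is the total number of key-value pairs emitted by the mappers over all documents. $\log$ denotes the natural logarithm. -}

module Defs where

open import Data.Fin.Base as Fin using (Fin)
import Data.Fin.Properties as Fin
open import Data.Fin.Subset as Subset using (Subset)
open import Data.Fin.Subset.Properties using (_∈?_)
open import Data.Integer.Base as ℤ using (+_; +≤+)
import Data.Integer.Properties as ℤ
open import Data.List.Base
  using (List; []; _∷_; _++_; map; concatMap; filter; foldr; allFin; cartesianProduct)
open import Data.List.Membership.Propositional using (_∈_)
open import Data.Nat.Base as ℕ using (ℕ; zero; suc; _∸_; NonZero)
import Data.Nat.Properties as ℕ
open import Data.Nat.Solver using (module +-*-Solver)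
open import Data.Product.Base using (∃-syntax; _×_; _,_; proj₁; proj₂)
open import Data.Rational.Base as ℚ using (ℚ; 0ℚ; 1ℚ; ½; _/_; ∣_∣; 1/_)
import Data.Rational.Properties as ℚ
import Data.Rational.Unnormalised.Base as ℚᵘ
import Data.Rational.Unnormalised.Properties as ℚᵘ
open import Data.Rational.Solver renaming (module +-*-Solver to ℚ-Solver)
open import Data.Sum.Base using (_⊎_; inj₁; inj₂)
open import Data.Vec.Base as Vec using (Vec)
open import Data.Vec.Relation.Unary.All as Vec using ()
open import Relation.Binary.PropositionalEquality
  using (_≡_; _≢_; refl; sym; trans; cong; cong₂; subst; subst₂; module ≡-Reasoning)
open import Relation.Nullary using (yes; no; contradiction)
open import Relation.Nullary.Decidable using (_×-dec_)

IsCauchy : (ℕ → ℚ) → Set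
IsCauchy s = ∀ ε → 0ℚ ℚ.< ε →
  ∃[ N ] ∀ m n → N ℕ.≤ m → N ℕ.≤ n → ∣ s m ℚ.- s n ∣ ℚ.≤ ε

record ℝ : Set where
  constructor mkℝ
  field
    seq      : ℕ → ℚ
    isCauchy : IsCauchy seq
open ℝ public

infix 4 _≤ᵣ_ _<ᵣ_ _≈ᵣ_

_≤ᵣ_ : ℝ → ℝ → Set
x ≤ᵣ y = ∀ ε → 0ℚ ℚ.< ε → ∃[ N ] ∀ n → N ℕ.≤ n → seq x n ℚ.≤ seq y n ℚ.+ ε

_≈ᵣ_ : ℝ → ℝ → Set
x ≈ᵣ y = ∀ ε → 0ℚ ℚ.< ε → ∃[ N ] ∀ n → N ℕ.≤ n → ∣ seq x n ℚ.- seq y n ∣ ℚ.≤ ε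

_<ᵣ_ : ℝ → ℝ → Set
x <ᵣ y = ∃[ δ ] 0ℚ ℚ.< δ × (∃[ N ] ∀ n → N ℕ.≤ n → seq x n ℚ.+ δ ℚ.≤ seq y n)

∣∣≤⇒≤+ : ∀ p q {ε} → ∣ p ℚ.- q ∣ ℚ.≤ ε → p ℚ.≤ q ℚ.+ ε
∣∣≤⇒≤+ p q {ε} h = begin
  p                        ≡⟨ solve 2 (λ p q → p := q :+ (p :- q)) refl p q ⟩
  q ℚ.+ (p ℚ.- q)          ≤⟨ ℚ.+-monoʳ-≤ q p≤∣p∣ ⟩
  q ℚ.+ ∣ p ℚ.- q ∣        ≤⟨ ℚ.+-monoʳ-≤ q h ⟩
  q ℚ.+ ε                  ∎
  where
  open ℚ.≤-Reasoning
  open ℚ-Solver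
  r = p ℚ.- q
  p≤∣p∣ : r ℚ.≤ ∣ r ∣
  p≤∣p∣ with ℚ.≤-total 0ℚ r
  ... | inj₁ 0≤r = ℚ.≤-reflexive (sym (ℚ.0≤p⇒∣p∣≡p 0≤r))
  ... | inj₂ r≤0 = ℚ.≤-trans r≤0 (ℚ.0≤∣p∣ r)

≤+⇒∣∣≤ : ∀ p q {ε} → p ℚ.≤ q ℚ.+ ε → q ℚ.≤ p ℚ.+ ε → ∣ p ℚ.- q ∣ ℚ.≤ ε
≤+⇒∣∣≤ p q {ε} h₁ h₂ with ℚ.∣p∣≡p∨∣p∣≡-p (p ℚ.- q)
... | inj₁ eq = begin
  ∣ p ℚ.- q ∣              ≡⟨ eq ⟩
  p ℚ.- q                  ≤⟨ ℚ.+-monoˡ-≤ (ℚ.- q) h₁ ⟩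
  q ℚ.+ ε ℚ.- q            ≡⟨ solve 2 (λ q e → q :+ e :- q := e) refl q ε ⟩
  ε                        ∎
  where
  open ℚ.≤-Reasoning
  open ℚ-Solver
... | inj₂ eq = begin
  ∣ p ℚ.- q ∣              ≡⟨ eq ⟩
  ℚ.- (p ℚ.- q)            ≡⟨ solve 2 (λ p q → :- (p :- q) := q :- p) refl p q ⟩
  q ℚ.- p                  ≤⟨ ℚ.+-monoˡ-≤ (ℚ.- p) h₂ ⟩
  p ℚ.+ ε ℚ.- p            ≡⟨ solve 2 (λ q e → q :+ e :- q := e) refl p ε ⟩
  ε                        ∎
  where
  open ℚ.≤-Reasoning
  open ℚ-Solver

one-sided : ∀ (s : ℕ → ℚ) →
  (∀ ε → 0ℚ ℚ.< ε → ∃[ N ] ∀ m n → N ℕ.≤ m → N ℕ.≤ n → s m ℚ.≤ s n ℚ.+ ε) → IsCauchy s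
one-sided s h ε ε>0 with h ε ε>0
... | N , f = N , λ m n N≤m N≤n → ≤+⇒∣∣≤ (s m) (s n) (f m n N≤m N≤n) (f n m N≤n N≤m)

+ℚ-cancelˡ-≤ : ∀ r {p q} → r ℚ.+ p ℚ.≤ r ℚ.+ q → p ℚ.≤ q
+ℚ-cancelˡ-≤ r {p} {q} h =
  subst₂ ℚ._≤_ (cancel p) (cancel q) (ℚ.+-monoʳ-≤ (ℚ.- r) h)
  where
  cancel : ∀ x → ℚ.- r ℚ.+ (r ℚ.+ x) ≡ x
  cancel = solve 2 (λ r x → :- r :+ (r :+ x) := x) refl r
    where
    open ℚ-Solver

*-pos : ∀ {p q} → 0ℚ ℚ.< p → 0ℚ ℚ.< q → 0ℚ ℚ.< p ℚ.* q
*-pos {p} {q} p>0 q>0 =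
  ℚ.positive⁻¹ _ {{ℚ.pos*pos⇒pos p {{ℚ.positive p>0}} q {{ℚ.positive q>0}}}}

0<½ : 0ℚ ℚ.< ½
0<½ = ℚ.positive⁻¹ ½

half+half : ∀ ε → ε ℚ.* ½ ℚ.+ ε ℚ.* ½ ≡ ε
half+half ε = trans (sym (ℚ.*-distribˡ-+ ε ½ ½)) (ℚ.*-identityʳ ε)

1/pos : ∀ {q} → 0ℚ ℚ.< q → ∃[ r ] 0ℚ ℚ.< r × r ℚ.* q ≡ 1ℚ
1/pos {q} q>0 = 1/ q , ℚ.positive⁻¹ _ {{ℚ.1/pos⇒pos q}} , ℚ.*-inverseˡ q
  where instance
    _ = ℚ.positive q>0
    _ = ℚ.pos⇒nonZero q {{ℚ.positive q>0}}

/-mono-≤ : ∀ a b c d .{{_ : NonZero b}} .{{_ : NonZero d}} →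
           a ℕ.* d ℕ.≤ c ℕ.* b → (+ a) / b ℚ.≤ (+ c) / d
/-mono-≤ a b@(suc b') c d@(suc d') h = ℚ.toℚᵘ-cancel-≤ (begin
  ℚ.toℚᵘ (ℚ.fromℚᵘ (ℚᵘ.mkℚᵘ (+ a) b'))  ≃⟨ ℚ.toℚᵘ-fromℚᵘ (ℚᵘ.mkℚᵘ (+ a) b') ⟩
  ℚᵘ.mkℚᵘ (+ a) b'                      ≤⟨ ℚᵘ.*≤* (subst₂ ℤ._≤_ (ℤ.pos-* a d) (ℤ.pos-* c b) (+≤+ h)) ⟩
  ℚᵘ.mkℚᵘ (+ c) d'                      ≃⟨ ℚ.toℚᵘ-fromℚᵘ (ℚᵘ.mkℚᵘ (+ c) d') ⟨
  ℚ.toℚᵘ (ℚ.fromℚᵘ (ℚᵘ.mkℚᵘ (+ c) d'))  ∎)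
  where
  open ℚᵘ.≤-Reasoning

/-+ : ∀ a b c d .{{_ : NonZero b}} .{{_ : NonZero d}} .{{_ : NonZero (b ℕ.* d)}} →
      (+ a) / b ℚ.+ (+ c) / d ≡ (+ (a ℕ.* d ℕ.+ c ℕ.* b)) / (b ℕ.* d)
/-+ a b@(suc b') c d@(suc d') = ℚ.toℚᵘ-injective (begin
  ℚ.toℚᵘ (ℚ.fromℚᵘ p ℚ.+ ℚ.fromℚᵘ q)
    ≈⟨ ℚ.toℚᵘ-homo-+ (ℚ.fromℚᵘ p) (ℚ.fromℚᵘ q) ⟩
  ℚ.toℚᵘ (ℚ.fromℚᵘ p) ℚᵘ.+ ℚ.toℚᵘ (ℚ.fromℚᵘ q)
    ≈⟨ ℚᵘ.+-cong (ℚ.toℚᵘ-fromℚᵘ p) (ℚ.toℚᵘ-fromℚᵘ q) ⟩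
  p ℚᵘ.+ q
    ≈⟨ ℚᵘ.*≡* (cong (ℤ._* (+ (b ℕ.* d))) (cong₂ ℤ._+_ (sym (ℤ.pos-* a d)) (sym (ℤ.pos-* c b)))) ⟩
  r
    ≈⟨ ℚ.toℚᵘ-fromℚᵘ r ⟨
  ℚ.toℚᵘ (ℚ.fromℚᵘ r) ∎)
  where
  open import Relation.Binary.Reasoning.Setoid ℚᵘ.≃-setoid
  p = ℚᵘ.mkℚᵘ (+ a) b'
  q = ℚᵘ.mkℚᵘ (+ c) d'
  r = ℚᵘ.mkℚᵘ (+ (a ℕ.* d ℕ.+ c ℕ.* b)) (d' ℕ.+ b' ℕ.* d)

1/suc : ℕ → ℚ
1/suc n = (+ 1) / suc n

0≤1/suc : ∀ n → 0ℚ ℚ.≤ 1/suc n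
0≤1/suc n = /-mono-≤ 0 1 1 (suc n) ℕ.z≤n

1/suc-antimono : ∀ {m n} → m ℕ.≤ n → 1/suc n ℚ.≤ 1/suc m
1/suc-antimono {m} {n} m≤n =
  /-mono-≤ 1 (suc n) 1 (suc m) (ℕ.*-monoʳ-≤ 1 (ℕ.s≤s m≤n))

archimedean : ∀ ε → 0ℚ ℚ.< ε → ∃[ N ] 1/suc N ℚ.≤ ε
archimedean ε ε>0 = positive-case ε {{ℚ.positive ε>0}}
  where
  positive-case : ∀ ε .{{_ : ℚ.Positive ε}} → ∃[ N ] 1/suc N ℚ.≤ ε
  positive-case ε@(ℚ.mkℚ (+ suc a) d _) = d ,
    subst (1/suc d ℚ.≤_) (ℚ.↥p/↧p≡p ε)
      (/-mono-≤ 1 (suc d) (suc a) (suc d) (ℕ.*-monoˡ-≤ (suc d) (ℕ.s≤s (ℕ.z≤n {a}))))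

infixl 6 _+ᵣ_ _-ᵣ_
infixl 7 _*ᵣ_ _⊓ᵣ_
infix  8 -ᵣ_ _⁻¹⟨_⟩

fromℚ : ℚ → ℝ
fromℚ q = mkℝ (λ _ → q) (one-sided _ λ ε ε>0 → 0 , λ _ _ _ _ → begin
  q          ≡⟨ ℚ.+-identityʳ q ⟨
  q ℚ.+ 0ℚ   ≤⟨ ℚ.+-monoʳ-≤ q (ℚ.<⇒≤ ε>0) ⟩
  q ℚ.+ ε    ∎)
  where
  open ℚ.≤-Reasoning

fromℕ : ℕ → ℝ
fromℕ n = fromℚ ((+ n) / 1)

0ᵣ 1ᵣ : ℝ
0ᵣ = fromℚ 0ℚ
1ᵣ = fromℚ 1ℚ

_+ᵣ_ : ℝ → ℝ → ℝ
mkℝ s cs +ᵣ mkℝ t ct = mkℝ (λ n → s n ℚ.+ t n) (one-sided _ proof)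
  where
  proof : ∀ ε → 0ℚ ℚ.< ε → ∃[ N ] ∀ m n → N ℕ.≤ m → N ℕ.≤ n →
          s m ℚ.+ t m ℚ.≤ (s n ℚ.+ t n) ℚ.+ ε
  proof ε ε>0 with cs (ε ℚ.* ½) (*-pos ε>0 0<½) | ct (ε ℚ.* ½) (*-pos ε>0 0<½)
  ... | N₁ , f | N₂ , g = N₁ ℕ.⊔ N₂ , λ m n N≤m N≤n → begin
    s m ℚ.+ t m
      ≤⟨ ℚ.+-mono-≤
           (∣∣≤⇒≤+ (s m) (s n) (f m n (ℕ.m⊔n≤o⇒m≤o N₁ N₂ N≤m) (ℕ.m⊔n≤o⇒m≤o N₁ N₂ N≤n)))
           (∣∣≤⇒≤+ (t m) (t n) (g m n (ℕ.m⊔n≤o⇒n≤o N₁ N₂ N≤m) (ℕ.m⊔n≤o⇒n≤o N₁ N₂ N≤n))) ⟩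
    (s n ℚ.+ ε ℚ.* ½) ℚ.+ (t n ℚ.+ ε ℚ.* ½)
      ≡⟨ solve 3 (λ a b c → (a :+ c) :+ (b :+ c) := (a :+ b) :+ (c :+ c)) refl
           (s n) (t n) (ε ℚ.* ½) ⟩
    (s n ℚ.+ t n) ℚ.+ (ε ℚ.* ½ ℚ.+ ε ℚ.* ½)
      ≡⟨ cong (s n ℚ.+ t n ℚ.+_) (half+half ε) ⟩
    (s n ℚ.+ t n) ℚ.+ ε ∎
    where
    open ℚ.≤-Reasoning
    open ℚ-Solver

-ᵣ_ : ℝ → ℝ
-ᵣ mkℝ s cs = mkℝ (λ n → ℚ.- s n) proof
  where
  proof : IsCauchy (λ n → ℚ.- s n)
  proof ε ε>0 with cs ε ε>0
  ... | N , f = N , λ m n N≤m N≤n → subst (ℚ._≤ ε)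
    (trans (sym (ℚ.∣-p∣≡∣p∣ (s m ℚ.- s n)))
           (cong ∣_∣ (ℚ.neg-distrib-+ (s m) (ℚ.- s n))))
    (f m n N≤m N≤n)

_-ᵣ_ : ℝ → ℝ → ℝ
x -ᵣ y = x +ᵣ (-ᵣ y)

cauchy-bounded : ∀ s → IsCauchy s →
  ∃[ B ] 0ℚ ℚ.< B × (∃[ N ] ∀ n → N ℕ.≤ n → ∣ s n ∣ ℚ.≤ B)
cauchy-bounded s cs with cs 1ℚ (ℚ.positive⁻¹ 1ℚ)
... | N , f = ∣ s N ∣ ℚ.+ 1ℚ
            , ℚ.+-mono-≤-< (ℚ.0≤∣p∣ (s N)) (ℚ.positive⁻¹ 1ℚ)
            , N , λ n N≤n → begin
  ∣ s n ∣                          ≡⟨ cong ∣_∣ (solve 2 (λ a b → a := b :+ (a :- b)) refl (s n) (s N)) ⟩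
  ∣ s N ℚ.+ (s n ℚ.- s N) ∣        ≤⟨ ℚ.∣p+q∣≤∣p∣+∣q∣ (s N) (s n ℚ.- s N) ⟩
  ∣ s N ∣ ℚ.+ ∣ s n ℚ.- s N ∣      ≤⟨ ℚ.+-monoʳ-≤ ∣ s N ∣ (f n N N≤n ℕ.≤-refl) ⟩
  ∣ s N ∣ ℚ.+ 1ℚ                   ∎
  where
  open ℚ.≤-Reasoning
  open ℚ-Solver

product-difference : ∀ a b c d →
  a ℚ.* b ℚ.- c ℚ.* d ≡ a ℚ.* (b ℚ.- d) ℚ.+ d ℚ.* (a ℚ.- c)
product-difference = solve 4
  (λ a b c d → a :* b :- c :* d := a :* (b :- d) :+ d :* (a :- c)) refl
  where
  open ℚ-Solver

*-mono-abs : ∀ {a b c d} → 0ℚ ℚ.< b → ∣ a ∣ ℚ.≤ b → ∣ c ∣ ℚ.≤ d → ∣ a ℚ.* c ∣ ℚ.≤ b ℚ.* d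
*-mono-abs {a} {b} {c} {d} b>0 a≤b c≤d = begin
  ∣ a ℚ.* c ∣        ≡⟨ ℚ.∣p*q∣≡∣p∣*∣q∣ a c ⟩
  ∣ a ∣ ℚ.* ∣ c ∣    ≤⟨ ℚ.*-monoʳ-≤-nonNeg ∣ c ∣ {{ℚ.∣-∣-nonNeg c}} a≤b ⟩
  b ℚ.* ∣ c ∣        ≤⟨ ℚ.*-monoˡ-≤-nonNeg b {{ℚ.nonNegative (ℚ.<⇒≤ b>0)}} c≤d ⟩
  b ℚ.* d            ∎
  where
  open ℚ.≤-Reasoning

*-close : ∀ {a b c d A B} → 0ℚ ℚ.< A → 0ℚ ℚ.< B → ∀ {δ₁ δ₂} →
  ∣ a ∣ ℚ.≤ A → ∣ d ∣ ℚ.≤ B → ∣ b ℚ.- d ∣ ℚ.≤ δ₁ → ∣ a ℚ.- c ∣ ℚ.≤ δ₂ →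
  ∣ a ℚ.* b ℚ.- c ℚ.* d ∣ ℚ.≤ A ℚ.* δ₁ ℚ.+ B ℚ.* δ₂
*-close {a} {b} {c} {d} {A} {B} A>0 B>0 {δ₁} {δ₂} a≤A d≤B b-d≤δ₁ a-c≤δ₂ = begin
  ∣ a ℚ.* b ℚ.- c ℚ.* d ∣
    ≡⟨ cong ∣_∣ (product-difference a b c d) ⟩
  ∣ a ℚ.* (b ℚ.- d) ℚ.+ d ℚ.* (a ℚ.- c) ∣
    ≤⟨ ℚ.∣p+q∣≤∣p∣+∣q∣ (a ℚ.* (b ℚ.- d)) (d ℚ.* (a ℚ.- c)) ⟩
  ∣ a ℚ.* (b ℚ.- d) ∣ ℚ.+ ∣ d ℚ.* (a ℚ.- c) ∣
    ≤⟨ ℚ.+-mono-≤ (*-mono-abs {a} {A} {b ℚ.- d} A>0 a≤A b-d≤δ₁)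
                  (*-mono-abs {d} {B} {a ℚ.- c} B>0 d≤B a-c≤δ₂) ⟩
  A ℚ.* δ₁ ℚ.+ B ℚ.* δ₂ ∎
  where
  open ℚ.≤-Reasoning

*-inverse-cancel : ∀ p q r → q ℚ.* p ≡ 1ℚ → p ℚ.* (q ℚ.* r) ≡ r
*-inverse-cancel p q r eq = trans (sym (ℚ.*-assoc p q r))
  (trans (cong (ℚ._* r) (trans (ℚ.*-comm p q) eq)) (ℚ.*-identityˡ r))

_*ᵣ_ : ℝ → ℝ → ℝ
mkℝ s cs *ᵣ mkℝ t ct = mkℝ (λ n → s n ℚ.* t n) proof
  where
  proof : IsCauchy (λ n → s n ℚ.* t n)
  proof ε ε>0 =
    let A , A>0 , N₁ , s≤A = cauchy-bounded s cs
        B , B>0 , N₂ , t≤B = cauchy-bounded t ct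
        A⁻¹ , A⁻¹>0 , A⁻¹A≡1 = 1/pos A>0
        B⁻¹ , B⁻¹>0 , B⁻¹B≡1 = 1/pos B>0
        ε/2 = ε ℚ.* ½
        ε/2>0 = *-pos ε>0 0<½
        N₃ , t-close = ct (A⁻¹ ℚ.* ε/2) (*-pos A⁻¹>0 ε/2>0)
        N₄ , s-close = cs (B⁻¹ ℚ.* ε/2) (*-pos B⁻¹>0 ε/2>0)
        δ-sum = trans (cong₂ ℚ._+_ (*-inverse-cancel A A⁻¹ ε/2 A⁻¹A≡1)
                                   (*-inverse-cancel B B⁻¹ ε/2 B⁻¹B≡1))
                      (half+half ε)
        N = (N₁ ℕ.⊔ N₂) ℕ.⊔ (N₃ ℕ.⊔ N₄)
        N₁≤N = ℕ.≤-trans (ℕ.m≤m⊔n N₁ N₂) (ℕ.m≤m⊔n (N₁ ℕ.⊔ N₂) (N₃ ℕ.⊔ N₄))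
        N₂≤N = ℕ.≤-trans (ℕ.m≤n⊔m N₁ N₂) (ℕ.m≤m⊔n (N₁ ℕ.⊔ N₂) (N₃ ℕ.⊔ N₄))
        N₃≤N = ℕ.≤-trans (ℕ.m≤m⊔n N₃ N₄) (ℕ.m≤n⊔m (N₁ ℕ.⊔ N₂) (N₃ ℕ.⊔ N₄))
        N₄≤N = ℕ.≤-trans (ℕ.m≤n⊔m N₃ N₄) (ℕ.m≤n⊔m (N₁ ℕ.⊔ N₂) (N₃ ℕ.⊔ N₄))
    in N , λ m n N≤m N≤n →
      ℚ.≤-trans
        (*-close {s m} {t m} {s n} {t n} A>0 B>0
          (s≤A m (ℕ.≤-trans N₁≤N N≤m)) (t≤B n (ℕ.≤-trans N₂≤N N≤n))
          (t-close m n (ℕ.≤-trans N₃≤N N≤m) (ℕ.≤-trans N₃≤N N≤n))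
          (s-close m n (ℕ.≤-trans N₄≤N N≤m) (ℕ.≤-trans N₄≤N N≤n)))
        (ℚ.≤-reflexive δ-sum)

_⊓ᵣ_ : ℝ → ℝ → ℝ
mkℝ s cs ⊓ᵣ mkℝ t ct = mkℝ (λ n → s n ℚ.⊓ t n) (one-sided _ proof)
  where
  proof : ∀ ε → 0ℚ ℚ.< ε → ∃[ N ] ∀ m n → N ℕ.≤ m → N ℕ.≤ n →
          s m ℚ.⊓ t m ℚ.≤ (s n ℚ.⊓ t n) ℚ.+ ε
  proof ε ε>0 with cs ε ε>0 | ct ε ε>0
  ... | N₁ , f | N₂ , g = N₁ ℕ.⊔ N₂ , λ m n N≤m N≤n → begin
    s m ℚ.⊓ t m
      ≤⟨ ℚ.⊓-mono-≤
           (∣∣≤⇒≤+ (s m) (s n) (f m n (ℕ.m⊔n≤o⇒m≤o N₁ N₂ N≤m) (ℕ.m⊔n≤o⇒m≤o N₁ N₂ N≤n)))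
           (∣∣≤⇒≤+ (t m) (t n) (g m n (ℕ.m⊔n≤o⇒n≤o N₁ N₂ N≤m) (ℕ.m⊔n≤o⇒n≤o N₁ N₂ N≤n))) ⟩
    (s n ℚ.+ ε) ℚ.⊓ (t n ℚ.+ ε)
      ≡⟨ ℚ.mono-≤-distrib-⊓ (ℚ.+-monoˡ-≤ ε) (s n) (t n) ⟨
    (s n ℚ.⊓ t n) ℚ.+ ε ∎
    where
    open ℚ.≤-Reasoning

-- Extended by 0 ↦ 0: a sequence with positive limit may still have zero
-- terms at the beginning.
recipℚ : ℚ → ℚ
recipℚ q with q ℚ.≟ 0ℚ
... | yes _   = 0ℚ
... | no q≢0 = (1/ q) {{ℚ.≢-nonZero q≢0}}

recipℚ-inverse : ∀ {q} → 0ℚ ℚ.< q → 0ℚ ℚ.< recipℚ q × recipℚ q ℚ.* q ≡ 1ℚ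
recipℚ-inverse {q} q>0 with q ℚ.≟ 0ℚ
... | yes q≡0 = contradiction (sym q≡0) (ℚ.<⇒≢ q>0)
... | no  q≢0 = ℚ.positive⁻¹ _ {{ℚ.1/pos⇒pos q {{ℚ.positive q>0}}}}
              , ℚ.*-inverseˡ q {{ℚ.≢-nonZero q≢0}}

_⁻¹⟨_⟩ : (x : ℝ) → 0ᵣ <ᵣ x → ℝ
mkℝ s cs ⁻¹⟨ δ , δ>0 , N₀ , pos ⟩ = mkℝ (λ n → recipℚ (s n)) (one-sided _ proof)
  where
  δ≤ : ∀ n → N₀ ℕ.≤ n → δ ℚ.≤ s n
  δ≤ n N₀≤n = subst (ℚ._≤ s n) (ℚ.+-identityˡ δ) (pos n N₀≤n)

  proof : ∀ ε → 0ℚ ℚ.< ε → ∃[ N ] ∀ m n → N ℕ.≤ m → N ℕ.≤ n →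
          recipℚ (s m) ℚ.≤ recipℚ (s n) ℚ.+ ε
  proof ε ε>0 with cs (ε ℚ.* (δ ℚ.* δ)) (*-pos ε>0 (*-pos δ>0 δ>0))
  ... | N₁ , f = N₀ ℕ.⊔ N₁ , λ m n N≤m N≤n →
    compare (δ≤ m (ℕ.m⊔n≤o⇒m≤o N₀ N₁ N≤m)) (δ≤ n (ℕ.m⊔n≤o⇒m≤o N₀ N₁ N≤n))
      (∣∣≤⇒≤+ (s n) (s m) (f n m (ℕ.m⊔n≤o⇒n≤o N₀ N₁ N≤n) (ℕ.m⊔n≤o⇒n≤o N₀ N₁ N≤m)))
    where
    compare : ∀ {a b} → δ ℚ.≤ a → δ ℚ.≤ b → b ℚ.≤ a ℚ.+ ε ℚ.* (δ ℚ.* δ) →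
              recipℚ a ℚ.≤ recipℚ b ℚ.+ ε
    compare {a} {b} δ≤a δ≤b b≤a+
      with ℚ.<-≤-trans δ>0 δ≤a | ℚ.<-≤-trans δ>0 δ≤b
    ... | a>0 | b>0 with recipℚ-inverse a>0 | recipℚ-inverse b>0
    ... | a⁻¹>0 , eqa | b⁻¹>0 , eqb =
      ℚ.*-cancelʳ-≤-pos (a ℚ.* b) {{ℚ.positive (*-pos a>0 b>0)}} (begin
        recipℚ a ℚ.* (a ℚ.* b)
          ≡⟨ trans (sym (ℚ.*-assoc (recipℚ a) a b)) (trans (cong (ℚ._* b) eqa) (ℚ.*-identityˡ b)) ⟩
        b
          ≤⟨ b≤a+ ⟩
        a ℚ.+ ε ℚ.* (δ ℚ.* δ)
          ≤⟨ ℚ.+-monoʳ-≤ a (ℚ.*-monoˡ-≤-nonNeg ε {{ℚ.nonNegative (ℚ.<⇒≤ ε>0)}} δδ≤ab) ⟩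
        a ℚ.+ ε ℚ.* (a ℚ.* b)
          ≡⟨ cong (ℚ._+ ε ℚ.* (a ℚ.* b)) (trans (sym (ℚ.*-identityˡ a)) (cong (ℚ._* a) (sym eqb))) ⟩
        (recipℚ b ℚ.* b) ℚ.* a ℚ.+ ε ℚ.* (a ℚ.* b)
          ≡⟨ solve 4 (λ a b e r → r :* b :* a :+ e :* (a :* b) := (r :+ e) :* (a :* b)) refl
               a b ε (recipℚ b) ⟩
        (recipℚ b ℚ.+ ε) ℚ.* (a ℚ.* b) ∎)
      where
      open ℚ.≤-Reasoning
      open ℚ-Solver
      δδ≤ab : δ ℚ.* δ ℚ.≤ a ℚ.* b
      δδ≤ab = ℚ.≤-trans
        (ℚ.*-monoʳ-≤-nonNeg δ {{ℚ.nonNegative (ℚ.<⇒≤ δ>0)}} δ≤a)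
        (ℚ.*-monoˡ-≤-nonNeg a {{ℚ.nonNegative (ℚ.<⇒≤ a>0)}} δ≤b)

sumᵣ : List ℝ → ℝ
sumᵣ = foldr _+ᵣ_ 0ᵣ

⌊√_⌋ : ℕ → ℕ
⌊√ zero ⌋ = zero
⌊√ suc n ⌋ with suc ⌊√ n ⌋ ℕ.* suc ⌊√ n ⌋ ℕ.≤? suc n
... | yes _ = suc ⌊√ n ⌋
... | no  _ = ⌊√ n ⌋

⌊√⌋-lower : ∀ n → ⌊√ n ⌋ ℕ.* ⌊√ n ⌋ ℕ.≤ n
⌊√⌋-lower zero = ℕ.z≤n
⌊√⌋-lower (suc n) with suc ⌊√ n ⌋ ℕ.* suc ⌊√ n ⌋ ℕ.≤? suc n
... | yes h = h
... | no  _ = ℕ.m≤n⇒m≤1+n (⌊√⌋-lower n)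

⌊√⌋-upper : ∀ n → n ℕ.< suc ⌊√ n ⌋ ℕ.* suc ⌊√ n ⌋
⌊√⌋-upper zero = ℕ.s≤s ℕ.z≤n
⌊√⌋-upper (suc n) with suc ⌊√ n ⌋ ℕ.* suc ⌊√ n ⌋ ℕ.≤? suc n
... | no h  = ℕ.≰⇒> h
... | yes _ = ℕ.≤-<-trans (⌊√⌋-upper n)
  (ℕ.*-mono-< (ℕ.n<1+n (suc ⌊√ n ⌋)) (ℕ.n<1+n (suc ⌊√ n ⌋)))

square-cancel-< : ∀ {a b} → a ℕ.* a ℕ.< b ℕ.* b → a ℕ.< b
square-cancel-< {a} {b} h = ℕ.≰⇒> λ b≤a → ℕ.<⇒≱ h (ℕ.*-mono-≤ b≤a b≤a)

-- The k-th approximant is √n rounded down to a multiple of 1/(k+1).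
√-seq : ℕ → ℕ → ℚ
√-seq n k = (+ ⌊√ n ℕ.* (suc k ℕ.* suc k) ⌋) / suc k

√-seq-close : ∀ n j k → √-seq n j ℚ.≤ √-seq n k ℚ.+ 1/suc k
√-seq-close n j k = ℚ.≤-trans (/-mono-≤ a J (suc b) K (ℕ.<⇒≤ aK<[1+b]J))
                              (ℚ.≤-reflexive eq)
  where
  J = suc j
  K = suc k
  a = ⌊√ n ℕ.* (J ℕ.* J) ⌋
  b = ⌊√ n ℕ.* (K ℕ.* K) ⌋
  open +-*-Solver
  aK<[1+b]J : a ℕ.* K ℕ.< suc b ℕ.* J
  aK<[1+b]J = square-cancel-< (begin-strict
    (a ℕ.* K) ℕ.* (a ℕ.* K)
      ≡⟨ solve 2 (λ a k → (a :* k) :* (a :* k) := (a :* a) :* (k :* k)) refl a K ⟩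
    (a ℕ.* a) ℕ.* (K ℕ.* K)
      ≤⟨ ℕ.*-monoˡ-≤ (K ℕ.* K) (⌊√⌋-lower (n ℕ.* (J ℕ.* J))) ⟩
    (n ℕ.* (J ℕ.* J)) ℕ.* (K ℕ.* K)
      ≡⟨ solve 3 (λ n j k → (n :* (j :* j)) :* (k :* k) := (n :* (k :* k)) :* (j :* j)) refl n J K ⟩
    (n ℕ.* (K ℕ.* K)) ℕ.* (J ℕ.* J)
      <⟨ ℕ.*-monoˡ-< (J ℕ.* J) (⌊√⌋-upper (n ℕ.* (K ℕ.* K))) ⟩
    (suc b ℕ.* suc b) ℕ.* (J ℕ.* J)
      ≡⟨ solve 2 (λ b j → (b :* b) :* (j :* j) := (b :* j) :* (b :* j)) refl (suc b) J ⟩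
    (suc b ℕ.* J) ℕ.* (suc b ℕ.* J) ∎)
    where
    open ℕ.≤-Reasoning
  lemma : (b ℕ.* K ℕ.+ 1 ℕ.* K) ℕ.* K ≡ suc b ℕ.* (K ℕ.* K)
  lemma = solve 2 (λ b k → (b :* k :+ con 1 :* k) :* k := (con 1 :+ b) :* (k :* k)) refl b K
  eq : (+ suc b) / K ≡ (+ b) / K ℚ.+ (+ 1) / K
  eq = ℚ.≤-antisym
    (ℚ.≤-trans (/-mono-≤ (suc b) K (b ℕ.* K ℕ.+ 1 ℕ.* K) (K ℕ.* K) (ℕ.≤-reflexive (sym lemma)))
               (ℚ.≤-reflexive (sym (/-+ b K 1 K))))
    (ℚ.≤-trans (ℚ.≤-reflexive (/-+ b K 1 K))
               (/-mono-≤ (b ℕ.* K ℕ.+ 1 ℕ.* K) (K ℕ.* K) (suc b) K (ℕ.≤-reflexive lemma)))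

√_ : ℕ → ℝ
√ n = mkℝ (√-seq n) (one-sided _ proof)
  where
  proof : ∀ ε → 0ℚ ℚ.< ε → ∃[ N ] ∀ j k → N ℕ.≤ j → N ℕ.≤ k →
          √-seq n j ℚ.≤ √-seq n k ℚ.+ ε
  proof ε ε>0 with archimedean ε ε>0
  ... | N , h = N , λ j k _ N≤k → ℚ.≤-trans (√-seq-close n j k)
    (ℚ.+-monoʳ-≤ (√-seq n k) (ℚ.≤-trans (1/suc-antimono N≤k) h))

√-pos : ∀ n → 0ᵣ <ᵣ √ suc n
√-pos n = 1ℚ , ℚ.positive⁻¹ 1ℚ , 0 , λ k _ → let K = suc k ; r = ⌊√ suc n ℕ.* (K ℕ.* K) ⌋ in
  ℚ.≤-trans (ℚ.≤-reflexive (ℚ.+-identityˡ 1ℚ))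
    (/-mono-≤ 1 1 r K (begin
      1 ℕ.* K    ≡⟨ ℕ.*-identityˡ K ⟩
      K          ≤⟨ ℕ.s≤s⁻¹ (square-cancel-< (ℕ.≤-<-trans (ℕ.m≤m+n (K ℕ.* K) _)
                      (⌊√⌋-upper (suc n ℕ.* (K ℕ.* K))))) ⟩
      r          ≡⟨ ℕ.*-identityʳ r ⟨
      r ℕ.* 1    ∎))
  where
  open ℕ.≤-Reasoning

-- 1/√n.  The value at n = 0 is a convention and is never reached for a word
-- that occurs in some document.
1/√_ : ℕ → ℝ
1/√ zero    = 0ᵣ
1/√ (suc n) = (√ suc n) ⁻¹⟨ √-pos n ⟩

-- harmonic m c = 1/(m+1) + 1/(m+2) + … + 1/(m+c)
harmonic : ℕ → ℕ → ℚ
harmonic m zero    = 0ℚ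
harmonic m (suc c) = 1/suc m ℚ.+ harmonic (suc m) c

-- Dividing [1 , n] into pieces of length 1/m, the right-endpoint Riemann sum
-- of ∫₁ⁿ dt/t is ∑_{1 ≤ j ≤ (n-1)m} (1/m) · 1/(1 + j/m), which is
-- harmonic m ((n-1)m).  (For n = 0 this gives the conventional value 0.)
log-seq : ℕ → ℕ → ℚ
log-seq n k = harmonic (suc k) ((n ∸ 1) ℕ.* suc k)

harmonic-++ : ∀ m c d → harmonic m (c ℕ.+ d) ≡ harmonic m c ℚ.+ harmonic (c ℕ.+ m) d
harmonic-++ m zero    d = sym (ℚ.+-identityˡ _)
harmonic-++ m (suc c) d = begin
  1/suc m ℚ.+ harmonic (suc m) (c ℕ.+ d)
    ≡⟨ cong (1/suc m ℚ.+_) (harmonic-++ (suc m) c d) ⟩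
  1/suc m ℚ.+ (harmonic (suc m) c ℚ.+ harmonic (c ℕ.+ suc m) d)
    ≡⟨ ℚ.+-assoc (1/suc m) (harmonic (suc m) c) (harmonic (c ℕ.+ suc m) d) ⟨
  harmonic m (suc c) ℚ.+ harmonic (c ℕ.+ suc m) d
    ≡⟨ cong (λ i → harmonic m (suc c) ℚ.+ harmonic i d) (ℕ.+-suc c m) ⟩
  harmonic m (suc c) ℚ.+ harmonic (suc c ℕ.+ m) d ∎
  where
  open ≡-Reasoning

/-+-same : ∀ a b n .{{_ : NonZero n}} → (+ a) / n ℚ.+ (+ b) / n ≡ (+ (a ℕ.+ b)) / n
/-+-same a b n@(suc _) = trans (/-+ a n b n) (ℚ.≤-antisym
  (/-mono-≤ (a ℕ.* n ℕ.+ b ℕ.* n) (n ℕ.* n) (a ℕ.+ b) n (ℕ.≤-reflexive lemma))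
  (/-mono-≤ (a ℕ.+ b) n (a ℕ.* n ℕ.+ b ℕ.* n) (n ℕ.* n) (ℕ.≤-reflexive (sym lemma))))
  where
  open +-*-Solver
  lemma : (a ℕ.* n ℕ.+ b ℕ.* n) ℕ.* n ≡ (a ℕ.+ b) ℕ.* (n ℕ.* n)
  lemma = solve 3 (λ a b n → (a :* n :+ b :* n) :* n := (a :+ b) :* (n :* n)) refl a b n

harmonic-upper : ∀ m c i .{{_ : NonZero i}} → i ℕ.≤ suc m → harmonic m c ℚ.≤ (+ c) / i
harmonic-upper m zero    i@(suc _) _     = /-mono-≤ 0 1 0 i ℕ.z≤n
harmonic-upper m (suc c) i@(suc _) i≤1+m = ℚ.≤-trans
  (ℚ.+-mono-≤ (1/suc-antimono (ℕ.s≤s⁻¹ i≤1+m))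
              (harmonic-upper (suc m) c i (ℕ.m≤n⇒m≤1+n i≤1+m)))
  (ℚ.≤-reflexive (/-+-same 1 c i))

harmonic-lower : ∀ m c i .{{_ : NonZero i}} → c ℕ.+ m ℕ.≤ i → (+ c) / i ℚ.≤ harmonic m c
harmonic-lower m zero    i@(suc _) _ = /-mono-≤ 0 i 0 1 ℕ.z≤n
harmonic-lower m (suc c) i@(suc _) h = ℚ.≤-trans
  (ℚ.≤-reflexive (sym (/-+-same 1 c i)))
  (ℚ.+-mono-≤ (1/suc-antimono (ℕ.≤-trans (ℕ.m≤n+m m c) (ℕ.s≤s⁻¹ h)))
              (harmonic-lower (suc m) c i (ℕ.≤-trans (ℕ.≤-reflexive (ℕ.+-suc c m)) h)))

module LogConvergence (n : ℕ) where
  private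
    c = n ∸ 1
    A = log-seq n

  -- A (k+1) + 1/(k+2) and A k + (1/(n(k+1)+1) + … + 1/(n(k+1)+n)) are two
  -- ways of splitting one harmonic sum.
  recurrence : ∀ k → 1/suc (suc k) ℚ.+ A (suc k)
                   ≡ A k ℚ.+ harmonic (suc c ℕ.* suc k) (suc c)
  recurrence k = begin
    harmonic (suc k) (suc (c ℕ.* suc (suc k)))
      ≡⟨ cong (harmonic (suc k)) (solve 2 (λ c k →
           con 1 :+ c :* (con 1 :+ k) := c :* k :+ (con 1 :+ c)) refl c (suc k)) ⟩
    harmonic (suc k) (c ℕ.* suc k ℕ.+ suc c)
      ≡⟨ harmonic-++ (suc k) (c ℕ.* suc k) (suc c) ⟩
    A k ℚ.+ harmonic (c ℕ.* suc k ℕ.+ suc k) (suc c)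
      ≡⟨ cong (λ i → A k ℚ.+ harmonic i (suc c)) (ℕ.+-comm (c ℕ.* suc k) (suc k)) ⟩
    A k ℚ.+ harmonic (suc c ℕ.* suc k) (suc c) ∎
    where
    open ≡-Reasoning
    open +-*-Solver

  A-suc-≥ : ∀ k → A k ℚ.≤ A (suc k)
  A-suc-≥ k = +ℚ-cancelˡ-≤ (1/suc (suc k)) (begin
    1/suc (suc k) ℚ.+ A k
      ≡⟨ ℚ.+-comm (1/suc (suc k)) (A k) ⟩
    A k ℚ.+ 1/suc (suc k)
      ≤⟨ ℚ.+-monoʳ-≤ (A k) (/-mono-≤ 1 (suc (suc k)) (suc c) M (ℕ.≤-reflexive (ℕ.*-identityˡ M))) ⟩
    A k ℚ.+ (+ suc c) / M
      ≤⟨ ℚ.+-monoʳ-≤ (A k) (harmonic-lower (suc c ℕ.* suc k) (suc c) M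
           (ℕ.≤-reflexive (sym (ℕ.*-suc (suc c) (suc k))))) ⟩
    A k ℚ.+ harmonic (suc c ℕ.* suc k) (suc c)
      ≡⟨ recurrence k ⟨
    1/suc (suc k) ℚ.+ A (suc k) ∎)
    where
    open ℚ.≤-Reasoning
    M = suc c ℕ.* suc (suc k)

  A+-suc-≤ : ∀ k → A (suc k) ℚ.+ 1/suc (suc k) ℚ.≤ A k ℚ.+ 1/suc k
  A+-suc-≤ k = begin
    A (suc k) ℚ.+ 1/suc (suc k)
      ≡⟨ ℚ.+-comm (A (suc k)) (1/suc (suc k)) ⟩
    1/suc (suc k) ℚ.+ A (suc k)
      ≡⟨ recurrence k ⟩
    A k ℚ.+ harmonic M (suc c)
      ≤⟨ ℚ.+-monoʳ-≤ (A k) (harmonic-upper M (suc c) M (ℕ.n≤1+n M)) ⟩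
    A k ℚ.+ (+ suc c) / M
      ≤⟨ ℚ.+-monoʳ-≤ (A k) (/-mono-≤ (suc c) M 1 (suc k)
           (ℕ.≤-reflexive (sym (ℕ.*-identityˡ M)))) ⟩
    A k ℚ.+ 1/suc k ∎
    where
    open ℚ.≤-Reasoning
    M = suc c ℕ.* suc k

  A-mono : ∀ i k → A k ℚ.≤ A (i ℕ.+ k)
  A-mono zero    k = ℚ.≤-refl
  A-mono (suc i) k = ℚ.≤-trans (A-mono i k) (A-suc-≥ (i ℕ.+ k))

  A+-antimono : ∀ i k → A (i ℕ.+ k) ℚ.+ 1/suc (i ℕ.+ k) ℚ.≤ A k ℚ.+ 1/suc k
  A+-antimono zero    k = ℚ.≤-refl
  A+-antimono (suc i) k = ℚ.≤-trans (A+-suc-≤ (i ℕ.+ k)) (A+-antimono i k)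

  A≤A+ : ∀ k q → 0ℚ ℚ.≤ q → A k ℚ.≤ A k ℚ.+ q
  A≤A+ k q 0≤q = ℚ.≤-trans (ℚ.≤-reflexive (sym (ℚ.+-identityʳ (A k)))) (ℚ.+-monoʳ-≤ (A k) 0≤q)

  A-close : ∀ j k → A j ℚ.≤ A k ℚ.+ 1/suc k
  A-close j k with ℕ.≤-total j k
  ... | inj₁ j≤k = ℚ.≤-trans
    (subst (λ i → A j ℚ.≤ A i) (ℕ.m∸n+n≡m j≤k) (A-mono (k ∸ j) j))
    (A≤A+ k (1/suc k) (0≤1/suc k))
  ... | inj₂ k≤j = ℚ.≤-trans (A≤A+ j (1/suc j) (0≤1/suc j))
    (subst (λ i → A i ℚ.+ 1/suc i ℚ.≤ A k ℚ.+ 1/suc k) (ℕ.m∸n+n≡m k≤j) (A+-antimono (j ∸ k) k))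

log : ℕ → ℝ
log n = mkℝ (log-seq n) (one-sided _ proof)
  where
  proof : ∀ ε → 0ℚ ℚ.< ε → ∃[ N ] ∀ j k → N ℕ.≤ j → N ℕ.≤ k →
          log-seq n j ℚ.≤ log-seq n k ℚ.+ ε
  proof ε ε>0 with archimedean ε ε>0
  ... | N , h = N , λ j k _ N≤k → ℚ.≤-trans (LogConvergence.A-close n j k)
    (ℚ.+-monoʳ-≤ (log-seq n k) (ℚ.≤-trans (1/suc-antimono N≤k) h))

-- Weighted outcomes.  That the weights are nonnegative with sum 1 is not part
-- of the type; outcomes may be listed repeatedly and with weight 0.
Dist : Set → Set
Dist A = List (ℝ × A)

return : ∀ {A} → A → Dist A
return a = (1ᵣ , a) ∷ []

infixl 1 _>>=_
_>>=_ : ∀ {A B} → Dist A → (A → Dist B) → Dist B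
μ >>= f = concatMap (λ (u , a) → map (λ (v , b) → u *ᵣ v , b) (f a)) μ

outcomes : ∀ {A} → Dist A → List A
outcomes = map proj₂

𝔼 : ∀ {A} → Dist A → (A → ℝ) → ℝ
𝔼 μ f = sumᵣ (map (λ (u , a) → u *ᵣ f a) μ)

emit_withProbability_ : ∀ {A} → A → ℝ → Dist (List A)
emit a withProbability q = (q , a ∷ []) ∷ (1ᵣ -ᵣ q , []) ∷ []

-- No emitter depends on the sampled xs, so the weights multiply: this is the
-- product distribution, with the outputs concatenated.
independently : ∀ {A} → List (Dist (List A)) → Dist (List A)
independently []       = return []
independently (μ ∷ μs) = μ >>= λ xs → independently μs >>= λ ys → return (xs ++ ys)

Word : ℕ → Set
Word = Fin

Corpus : ℕ → ℕ → Set
Corpus D N = Vec (Subset D) N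

AtMost_WordsPerDocument : ∀ (L : ℕ) {D N} → Corpus D N → Set
AtMost L WordsPerDocument T = Vec.All (λ t → Subset.∣ t ∣ ℕ.≤ L) T

module _ {D N : ℕ} (T : Corpus D N) where

  #₁ : Word D → ℕ
  #₁ w = Vec.count (w ∈?_) T

  #₂ : Word D → Word D → ℕ
  #₂ x y = Vec.count (λ t → x ∈? t ×-dec y ∈? t) T

  cosine : Word D → Word D → ℝ
  cosine x y = fromℕ (#₂ x y) *ᵣ (1/√ #₁ x *ᵣ 1/√ #₁ y)

-- An unordered pair of distinct words is represented by the pair (i , j) with i < j.
pairsIn : ∀ {D} → Subset D → List (Word D × Word D)
pairsIn {D} t = filter (λ (i , j) → i Fin.<? j ×-dec (i ∈? t ×-dec j ∈? t))
                       (cartesianProduct (allFin D) (allFin D))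

KeyValue : ℕ → Set
KeyValue D = (Word D × Word D) × ℕ

module CosineSampleEmit (p ε : ℝ) (ε>0 : 0ᵣ <ᵣ ε) {D N : ℕ} (T : Corpus D N) where

  p/ε : ℝ
  p/ε = p *ᵣ ε ⁻¹⟨ ε>0 ⟩

  emitProbability : Word D → Word D → ℝ
  emitProbability i j = 1ᵣ ⊓ᵣ (p/ε *ᵣ (1/√ #₁ T i *ᵣ 1/√ #₁ T j))

  mapper : Subset D → Dist (List (KeyValue D))
  mapper t = independently
    (map (λ (i , j) → emit ((i , j) , 1) withProbability emitProbability i j) (pairsIn t))

  shuffle : Dist (List (KeyValue D))
  shuffle = independently (map mapper (Vec.toList T))

ContainsAllSimilarPairs : ∀ {D N} → ℝ → Corpus D N → List (Word D × Word D) → Set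
ContainsAllSimilarPairs ε T out =
  ∀ x y → x ≢ y → ε ≤ᵣ cosine T x y → (x , y) ∈ out ⊎ (y , x) ∈ out

Algorithm : ℕ → Set
Algorithm D = ∀ {N} → Corpus D N → List (Word D × Word D)

OutputsAllSimilarPairs : ∀ {D} → ℕ → ℝ → Algorithm D → Set
OutputsAllSimilarPairs {D} L ε alg =
  ∀ {N} (T : Corpus D N) → AtMost L WordsPerDocument T → ContainsAllSimilarPairs ε T (alg T)

{-# OPTIONS --safe #-}
module Submission where

-- Upper bound.  By linearity the expected shuffle size is at most p/ε times the
-- sum over documents t and pairs i < j in t of 1/√#(i) · 1/√#(j).  By AM-GM each
-- summand is at most 1/(2#(i)) + 1/(2#(j)), so a word i is charged at most L/(2#(i))
-- by each of the #(i) documents containing it.  All of this is an inequality between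
-- the rational approximants from some index on: the probabilities of each emitter sum
-- to exactly 1 at every index, and the spare factor 2 in L/2 absorbs the rounding
-- error of the square roots.
--
-- Lower bound.  Partition the words into D/L blocks of L words, one document per
-- block: all D/L · C(L,2) pairs within a block have cosine similarity 1.

open import Defs
open import Data.Bool.Base using (if_then_else_; true; false)
open import Data.Fin using (Fin; zero; suc; combine; _<_)
import Data.Fin.Base as Fin
import Data.Fin.Properties as Fin
open import Data.Fin.Subset as Subset using (Subset; ∣_∣; inside; outside)
open import Data.Fin.Subset.Properties using (_∈?_; ∣⊤∣≡n; ∣⊥∣≡0; ∉⊥)
open import Data.Integer.Base as ℤ using (+_)
import Data.Integer.Properties as ℤ
open import Data.List using
  ( List; []; _∷_; _++_; length; lookup; map; concatMap; filter; allFin; tabulate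
  ; cartesianProduct; cartesianProductWith)
open import Data.List.Membership.Propositional using (_∈_)
open import Data.List.Membership.Propositional.Properties using (∈-map⁺; ∈-map⁻; ∈-lookup)
import Data.List.Properties as List
open import Data.List.Relation.Unary.All as All using (All; []; _∷_)
import Data.List.Relation.Unary.All.Properties as All
open import Data.List.Relation.Unary.AllPairs using ([]; _∷_)
open import Data.List.Relation.Unary.Any as Any using ()
open import Data.List.Relation.Unary.Any.Properties using (lookup-index)
open import Data.List.Relation.Unary.Unique.Propositional using (Unique)
import Data.List.Relation.Unary.Unique.Propositional.Properties as Unique
open import Data.Nat using (ℕ; zero; suc; z≤n; s≤s; _*_; _≤_; NonZero)
import Data.Nat.Base as ℕ
open import Data.Nat.Combinatorics using (_C_; nC1≡n; nCk+nC[k+1]≡[n+1]C[k+1])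
open import Data.Nat.Divisibility using (_∣_; divides; quotient)
import Data.Nat.Properties as ℕ
open import Data.Nat.Solver using (module +-*-Solver)
open import Data.Product using (∃-syntax; Σ-syntax; _×_; _,_; proj₁; proj₂)
open import Data.Rational.Base as ℚ using (ℚ; 0ℚ; 1ℚ; _/_)
import Data.Rational.Properties as ℚ
open import Data.Rational.Solver renaming (module +-*-Solver to ℚ-Solver)
import Data.Rational.Unnormalised.Base as ℚᵘ
import Data.Rational.Unnormalised.Properties as ℚᵘ
open import Data.Sum.Base using (_⊎_; inj₁; inj₂)
open import Data.Vec.Base as Vec using (Vec; []; _∷_)
import Data.Vec.Properties as Vec
open import Data.Vec.Relation.Unary.All.Properties using (tabulate⁺; toList⁺)
open import Function.Base using (_∘_)
open import Relation.Binary.PropositionalEquality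
  using (_≡_; refl; sym; trans; cong; cong₂; subst; subst₂; setoid; module ≡-Reasoning)
open import Relation.Nullary using (¬_; Dec; does; yes; no; contradiction; _because_)
open import Relation.Nullary.Decidable using (_×-dec_; dec-true; dec-false)
open import Relation.Unary using (Decidable)

private variable
  A B : Set

-- Inequalities and fractions in the rationals.

0≤*0≤ : ∀ {p q} → 0ℚ ℚ.≤ p → 0ℚ ℚ.≤ q → 0ℚ ℚ.≤ p ℚ.* q
0≤*0≤ {p} {q} 0≤p 0≤q =
  ℚ.nonNegative⁻¹ _ {{ℚ.nonNeg*nonNeg⇒nonNeg p {{ℚ.nonNegative 0≤p}} q {{ℚ.nonNegative 0≤q}}}}

*-mono-≤ˡ : ∀ {p q r} → 0ℚ ℚ.≤ r → p ℚ.≤ q → r ℚ.* p ℚ.≤ r ℚ.* q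
*-mono-≤ˡ {r = r} 0≤r = ℚ.*-monoˡ-≤-nonNeg r {{ℚ.nonNegative 0≤r}}

*-mono-≤ʳ : ∀ {p q r} → 0ℚ ℚ.≤ r → p ℚ.≤ q → p ℚ.* r ℚ.≤ q ℚ.* r
*-mono-≤ʳ {r = r} 0≤r = ℚ.*-monoʳ-≤-nonNeg r {{ℚ.nonNegative 0≤r}}

0≤p*p : ∀ p → 0ℚ ℚ.≤ p ℚ.* p
0≤p*p p with ℚ.≤-total 0ℚ p
... | inj₁ 0≤p = 0≤*0≤ 0≤p 0≤p
... | inj₂ p≤0 = subst (0ℚ ℚ.≤_) (solve 1 (λ p → :- p :* :- p := p :* p) refl p)
                       (0≤*0≤ (ℚ.neg-antimono-≤ p≤0) (ℚ.neg-antimono-≤ p≤0))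
  where open ℚ-Solver

halve-≤ : ∀ {p q} → p ℚ.+ p ℚ.≤ q ℚ.+ q → p ℚ.≤ q
halve-≤ h = ℚ.≮⇒≥ λ q<p → ℚ.<-irrefl refl (ℚ.<-≤-trans (ℚ.+-mono-< q<p q<p) h)

-- AM-GM: adding the square `(p - q)²` to `2pq` gives `p² + q²`. The hypotheses have the doubled
-- form `a + a` because the approximate squares of `1/√ m` are only bounded by `2/m`.
p*q≤a+b : ∀ {p q a b} → p ℚ.* p ℚ.≤ a ℚ.+ a → q ℚ.* q ℚ.≤ b ℚ.+ b → p ℚ.* q ℚ.≤ a ℚ.+ b
p*q≤a+b {p} {q} {a} {b} pp≤ qq≤ = halve-≤ (begin
  p ℚ.* q ℚ.+ p ℚ.* q
    ≡⟨ ℚ.+-identityʳ _ ⟨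
  p ℚ.* q ℚ.+ p ℚ.* q ℚ.+ 0ℚ
    ≤⟨ ℚ.+-monoʳ-≤ (p ℚ.* q ℚ.+ p ℚ.* q) (0≤p*p (p ℚ.- q)) ⟩
  p ℚ.* q ℚ.+ p ℚ.* q ℚ.+ (p ℚ.- q) ℚ.* (p ℚ.- q)
    ≡⟨ solve 2 (λ p q → p :* q :+ p :* q :+ (p :- q) :* (p :- q) := p :* p :+ q :* q) refl p q ⟩
  p ℚ.* p ℚ.+ q ℚ.* q
    ≤⟨ ℚ.+-mono-≤ pp≤ qq≤ ⟩
  (a ℚ.+ a) ℚ.+ (b ℚ.+ b)
    ≡⟨ solve 2 (λ a b → (a :+ a) :+ (b :+ b) := (a :+ b) :+ (a :+ b)) refl a b ⟩
  (a ℚ.+ b) ℚ.+ (a ℚ.+ b) ∎)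
  where
  open ℚ.≤-Reasoning
  open ℚ-Solver

/-* : ∀ a b c d .{{_ : NonZero b}} .{{_ : NonZero d}} .{{_ : NonZero (b * d)}} →
      ((+ a) / b) ℚ.* ((+ c) / d) ≡ (+ (a * c)) / (b * d)
/-* a b@(suc b') c d@(suc d') = ℚ.toℚᵘ-injective (begin
  ℚ.toℚᵘ (ℚ.fromℚᵘ p ℚ.* ℚ.fromℚᵘ q)
    ≈⟨ ℚ.toℚᵘ-homo-* (ℚ.fromℚᵘ p) (ℚ.fromℚᵘ q) ⟩
  ℚ.toℚᵘ (ℚ.fromℚᵘ p) ℚᵘ.* ℚ.toℚᵘ (ℚ.fromℚᵘ q)
    ≈⟨ ℚᵘ.*-cong (ℚ.toℚᵘ-fromℚᵘ p) (ℚ.toℚᵘ-fromℚᵘ q) ⟩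
  p ℚᵘ.* q
    ≈⟨ ℚᵘ.*≡* (cong (ℤ._* (+ (b * d))) (sym (ℤ.pos-* a c))) ⟩
  r
    ≈⟨ ℚ.toℚᵘ-fromℚᵘ r ⟨
  ℚ.toℚᵘ (ℚ.fromℚᵘ r) ∎)
  where
  open import Relation.Binary.Reasoning.Setoid ℚᵘ.≃-setoid
  p = ℚᵘ.mkℚᵘ (+ a) b'
  q = ℚᵘ.mkℚᵘ (+ c) d'
  r = ℚᵘ.mkℚᵘ (+ (a * c)) (d' ℕ.+ b' * d)

-- Every term of the constant sequence `fromℕ n` reduces to `ι n`.
ι : ℕ → ℚ
ι n = (+ n) / 1

ι-+ : ∀ m n → ι (m ℕ.+ n) ≡ ι m ℚ.+ ι n
ι-+ m n = sym (/-+-same m n 1)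

ι-mono : ∀ {m n} → m ≤ n → ι m ℚ.≤ ι n
ι-mono {m} {n} m≤n = /-mono-≤ m 1 n 1 (ℕ.*-monoˡ-≤ 1 m≤n)

0≤ι : ∀ n → 0ℚ ℚ.≤ ι n
0≤ι n = ι-mono (z≤n {n})

-- Finite sums

∑ : List A → (A → ℚ) → ℚ
∑ []       f = 0ℚ
∑ (x ∷ xs) f = f x ℚ.+ ∑ xs f

∑-cong : ∀ (xs : List A) {f g} → (∀ x → f x ≡ g x) → ∑ xs f ≡ ∑ xs g
∑-cong []       f≗g = refl
∑-cong (x ∷ xs) f≗g = cong₂ ℚ._+_ (f≗g x) (∑-cong xs f≗g)

∑-mono-All : ∀ {xs : List A} {f g} → All (λ x → f x ℚ.≤ g x) xs → ∑ xs f ℚ.≤ ∑ xs g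
∑-mono-All []       = ℚ.≤-refl
∑-mono-All (h ∷ hs) = ℚ.+-mono-≤ h (∑-mono-All hs)

∑-mono : ∀ (xs : List A) {f g} → (∀ x → f x ℚ.≤ g x) → ∑ xs f ℚ.≤ ∑ xs g
∑-mono xs f≤g = ∑-mono-All (All.universal f≤g xs)

∑-++ : ∀ (xs ys : List A) f → ∑ (xs ++ ys) f ≡ ∑ xs f ℚ.+ ∑ ys f
∑-++ []       ys f = sym (ℚ.+-identityˡ _)
∑-++ (x ∷ xs) ys f = trans (cong (f x ℚ.+_) (∑-++ xs ys f)) (sym (ℚ.+-assoc (f x) (∑ xs f) (∑ ys f)))

∑-map : ∀ (g : A → B) xs f → ∑ (map g xs) f ≡ ∑ xs (f ∘ g)
∑-map g []       f = refl
∑-map g (x ∷ xs) f = cong (f (g x) ℚ.+_) (∑-map g xs f)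

∑-concatMap : ∀ (g : A → List B) xs f → ∑ (concatMap g xs) f ≡ ∑ xs (λ x → ∑ (g x) f)
∑-concatMap g []       f = refl
∑-concatMap g (x ∷ xs) f =
  trans (∑-++ (g x) (concatMap g xs) f) (cong (∑ (g x) f ℚ.+_) (∑-concatMap g xs f))

∑-+ : ∀ (xs : List A) (f g : A → ℚ) → ∑ xs (λ x → f x ℚ.+ g x) ≡ ∑ xs f ℚ.+ ∑ xs g
∑-+ []       f g = sym (ℚ.+-identityˡ 0ℚ)
∑-+ (x ∷ xs) f g = trans (cong ((f x ℚ.+ g x) ℚ.+_) (∑-+ xs f g))
  (solve 4 (λ a b c d → (a :+ b) :+ (c :+ d) := (a :+ c) :+ (b :+ d)) refl
    (f x) (g x) (∑ xs f) (∑ xs g))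
  where open ℚ-Solver

∑-*ˡ : ∀ (xs : List A) c f → ∑ xs (λ x → c ℚ.* f x) ≡ c ℚ.* ∑ xs f
∑-*ˡ []       c f = sym (ℚ.*-zeroʳ c)
∑-*ˡ (x ∷ xs) c f =
  trans (cong (c ℚ.* f x ℚ.+_) (∑-*ˡ xs c f)) (sym (ℚ.*-distribˡ-+ c (f x) (∑ xs f)))

∑-*ʳ : ∀ (xs : List A) c f → ∑ xs (λ x → f x ℚ.* c) ≡ ∑ xs f ℚ.* c
∑-*ʳ xs c f = trans (∑-cong xs (λ x → ℚ.*-comm (f x) c)) (trans (∑-*ˡ xs c f) (ℚ.*-comm c (∑ xs f)))

∑-0 : ∀ (xs : List A) → ∑ xs (λ _ → 0ℚ) ≡ 0ℚ
∑-0 []       = refl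
∑-0 (x ∷ xs) = trans (ℚ.+-identityˡ _) (∑-0 xs)

∑-1 : ∀ (xs : List A) → ∑ xs (λ _ → 1ℚ) ≡ ι (length xs)
∑-1 []       = refl
∑-1 (x ∷ xs) = trans (cong (1ℚ ℚ.+_) (∑-1 xs)) (sym (ι-+ 1 (length xs)))

∑-swap : ∀ (xs : List A) (ys : List B) (f : A → B → ℚ) →
         ∑ xs (λ x → ∑ ys (λ y → f x y)) ≡ ∑ ys (λ y → ∑ xs (λ x → f x y))
∑-swap []       ys f = sym (∑-0 ys)
∑-swap (x ∷ xs) ys f = trans (cong (∑ ys (f x) ℚ.+_) (∑-swap xs ys f))
  (sym (∑-+ ys (f x) (λ y → ∑ xs (λ x → f x y))))

∑-cartesianProduct : ∀ (xs : List A) (ys : List B) f →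
  ∑ (cartesianProduct xs ys) f ≡ ∑ xs (λ x → ∑ ys (λ y → f (x , y)))
∑-cartesianProduct []       ys f = refl
∑-cartesianProduct (x ∷ xs) ys f = trans (∑-++ (map (x ,_) ys) (cartesianProduct xs ys) f)
  (cong₂ ℚ._+_ (∑-map (x ,_) ys f) (∑-cartesianProduct xs ys f))

∑-tabulate : ∀ {n} (g : Fin n → A) f → ∑ (tabulate g) f ≡ ∑ (allFin n) (f ∘ g)
∑-tabulate {n = n} g f =
  trans (cong (λ xs → ∑ xs f) (sym (List.map-tabulate (λ i → i) g))) (∑-map g (allFin n) f)

-- Only the `does` field is read, so that the indicator reduces in step with `filter`, `Vec.count`
-- and `×-dec`.
𝟙 : {P : Set} → Dec P → ℚ
𝟙 d = if does d then 1ℚ else 0ℚ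

0≤𝟙 : ∀ {P : Set} (d : Dec P) → 0ℚ ℚ.≤ 𝟙 d
0≤𝟙 (true  because _) = 0≤ι 1
0≤𝟙 (false because _) = ℚ.≤-refl

𝟙-× : ∀ {P Q : Set} (d : Dec P) (e : Dec Q) → 𝟙 (d ×-dec e) ≡ 𝟙 d ℚ.* 𝟙 e
𝟙-× (true  because _) e = sym (ℚ.*-identityˡ (𝟙 e))
𝟙-× (false because _) e = sym (ℚ.*-zeroˡ (𝟙 e))

𝟙+𝟙≤1 : ∀ {P Q : Set} (d : Dec P) (e : Dec Q) → (P → ¬ Q) → 𝟙 d ℚ.+ 𝟙 e ℚ.≤ 1ℚ
𝟙+𝟙≤1 (yes p) (yes q) P→¬Q = contradiction q (P→¬Q p)
𝟙+𝟙≤1 (yes _) (no _)  _    = ℚ.≤-refl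
𝟙+𝟙≤1 (no _)  (yes _) _    = ℚ.≤-refl
𝟙+𝟙≤1 (no _)  (no _)  _    = 0≤ι 1

∑-filter : ∀ {P : A → Set} (P? : Decidable P) xs f →
           ∑ (filter P? xs) f ≡ ∑ xs (λ x → 𝟙 (P? x) ℚ.* f x)
∑-filter P? []       f = refl
∑-filter P? (x ∷ xs) f with P? x
... | true  because _ = cong₂ ℚ._+_ (sym (ℚ.*-identityˡ (f x))) (∑-filter P? xs f)
... | false because _ = trans (∑-filter P? xs f) (trans (sym (ℚ.+-identityˡ _))
                          (cong (ℚ._+ _) (sym (ℚ.*-zeroˡ (f x)))))

∑-count : ∀ {P : A → Set} (P? : Decidable P) {n} (xs : Vec A n) →
          ∑ (Vec.toList xs) (𝟙 ∘ P?) ≡ ι (Vec.count P? xs)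
∑-count P? []       = refl
∑-count P? (x ∷ xs) with P? x
... | true  because _ = trans (cong (1ℚ ℚ.+_) (∑-count P? xs)) (sym (ι-+ 1 (Vec.count P? xs)))
... | false because _ = trans (ℚ.+-identityˡ _) (∑-count P? xs)

∑-∣∣ : ∀ {n} (t : Subset n) → ∑ (allFin n) (λ i → 𝟙 (i ∈? t)) ≡ ι ∣ t ∣
∑-∣∣ []          = refl
∑-∣∣ {suc n} (b ∷ t) = trans (cong (𝟙 (zero ∈? b ∷ t) ℚ.+_)
                     -- After reindexing by `suc`, the indicator of `suc i ∈? b ∷ t` reduces to that
                     -- of `i ∈? t`.
                     (trans (∑-tabulate (suc {n}) (λ i → 𝟙 (i ∈? b ∷ t))) (∑-∣∣ t)))
                   (head b)
  where
  head : ∀ b → 𝟙 (zero ∈? b ∷ t) ℚ.+ ι ∣ t ∣ ≡ ι ∣ b ∷ t ∣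
  head true  = sym (ι-+ 1 ∣ t ∣)
  head false = ℚ.+-identityˡ _

-- Expectations, at a fixed index of the Cauchy sequences

mean : ℕ → Dist A → (A → ℚ) → ℚ
mean n μ g = ∑ μ (λ (u , a) → seq u n ℚ.* g a)

-- `_+ᵣ_` and `_*ᵣ_` act termwise, so expectations of reals become exact weighted sums of rationals,
-- one for each index.
seq-𝔼 : ∀ n (μ : Dist A) f → seq (𝔼 μ f) n ≡ mean n μ (λ a → seq (f a) n)
seq-𝔼 n []            f = refl
seq-𝔼 n ((u , a) ∷ μ) f = cong (seq u n ℚ.* seq (f a) n ℚ.+_) (seq-𝔼 n μ f)

mean-return : ∀ n (a : A) g → mean n (return a) g ≡ g a
mean-return n a g = trans (ℚ.+-identityʳ _) (ℚ.*-identityˡ (g a))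

-- Law of total expectation.
mean->>= : ∀ n (μ : Dist A) (k : A → Dist B) g →
           mean n (μ >>= k) g ≡ mean n μ (λ a → mean n (k a) g)
mean->>= {A} {B} n μ k g = trans (∑-concatMap scaled μ _) (∑-cong μ inner)
  where
  scaled : ℝ × A → Dist B
  scaled (u , a) = map (λ (v , b) → u *ᵣ v , b) (k a)
  inner : ∀ ((u , a) : ℝ × A) →
          mean n (scaled (u , a)) g ≡ seq u n ℚ.* mean n (k a) g
  inner (u , a) = trans (∑-map _ (k a) _)
    (trans (∑-cong (k a) (λ (v , b) → ℚ.*-assoc (seq u n) (seq v n) (g b)))
           (∑-*ˡ (k a) (seq u n) _))

mean-+ : ∀ n (μ : Dist A) g h → mean n μ (λ a → g a ℚ.+ h a) ≡ mean n μ g ℚ.+ mean n μ h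
mean-+ n μ g h = trans (∑-cong μ (λ (u , a) → ℚ.*-distribˡ-+ (seq u n) (g a) (h a)))
  (∑-+ μ (λ (u , a) → seq u n ℚ.* g a) (λ (u , a) → seq u n ℚ.* h a))

mean-cong : ∀ n (μ : Dist A) {g h} → (∀ a → g a ≡ h a) → mean n μ g ≡ mean n μ h
mean-cong n μ g≗h = ∑-cong μ (λ (u , a) → cong (seq u n ℚ.*_) (g≗h a))

-- An exact equation at one index rather than `≈ᵣ`; with it the mean of a constant is that constant,
-- with no error term.
Normalised : ℕ → Dist A → Set
Normalised n μ = mean n μ (λ _ → 1ℚ) ≡ 1ℚ

mean-const : ∀ n (μ : Dist A) → Normalised n μ → ∀ c → mean n μ (λ _ → c) ≡ c
mean-const n μ μ-normalised c = trans
  (∑-cong μ (λ (u , a) → cong (ℚ._* c) (sym (ℚ.*-identityʳ (seq u n)))))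
  (trans (∑-*ʳ μ c _) (trans (cong (ℚ._* c) μ-normalised) (ℚ.*-identityˡ c)))

normalised->>= : ∀ n (μ : Dist A) (k : A → Dist B) →
  Normalised n μ → (∀ a → Normalised n (k a)) → Normalised n (μ >>= k)
normalised->>= n μ k μ-normalised k-normalised =
  trans (mean->>= n μ k (λ _ → 1ℚ)) (trans (mean-cong n μ k-normalised) μ-normalised)

normalised-return : ∀ n (a : A) → Normalised n (return a)
normalised-return n a = mean-return n a (λ _ → 1ℚ)

normalised-independently : ∀ n {μs : List (Dist (List A))} →
  All (Normalised n) μs → Normalised n (independently μs)
normalised-independently {A} n []                = normalised-return {A = List A} n []
normalised-independently n {μ ∷ μs} (h ∷ hs) =
  normalised->>= n μ (λ xs → independently μs >>= λ ys → return (xs ++ ys)) h λ xs →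
  normalised->>= n (independently μs) (λ ys → return (xs ++ ys)) (normalised-independently n hs) λ ys →
    normalised-return n (xs ++ ys)

lengthℚ : List A → ℚ
lengthℚ xs = ι (length xs)

meanLength : ℕ → Dist (List A) → ℚ
meanLength n μ = mean n μ lengthℚ

-- Linearity of expectation: lengths add under `++`, and normalisation lets the length contributed
-- by the other factor pass through each mean unchanged.
meanLength-independently : ∀ n {μs : List (Dist (List A))} → All (Normalised n) μs →
  meanLength n (independently μs) ≡ ∑ μs (meanLength n)
meanLength-independently {A} n []                = mean-return {A = List A} n [] lengthℚ
meanLength-independently {A} n {μ ∷ μs} (h ∷ hs) = begin
  meanLength n (μ >>= λ xs → rest >>= λ ys → return (xs ++ ys))
    ≡⟨ mean->>= n μ (λ xs → rest >>= λ ys → return (xs ++ ys)) lengthℚ ⟩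
  mean n μ (λ xs → meanLength n (rest >>= λ ys → return (xs ++ ys)))
    ≡⟨ mean-cong n μ inner ⟩
  -- For each sampled `xs`, the rest contributes the same constant `s`.
  mean n μ (λ xs → lengthℚ xs ℚ.+ s)
    ≡⟨ mean-+ n μ lengthℚ (λ _ → s) ⟩
  meanLength n μ ℚ.+ mean n μ (λ _ → s)
    ≡⟨ cong (meanLength n μ ℚ.+_) (mean-const n μ h s) ⟩
  meanLength n μ ℚ.+ s ∎
  where
  open ≡-Reasoning
  rest = independently μs
  s = ∑ μs (meanLength n)
  inner : ∀ xs → meanLength n (rest >>= λ ys → return (xs ++ ys)) ≡ lengthℚ xs ℚ.+ s
  inner xs = begin
    meanLength n (rest >>= λ ys → return (xs ++ ys))
      ≡⟨ mean->>= n rest (λ ys → return (xs ++ ys)) lengthℚ ⟩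
    mean n rest (λ ys → meanLength n (return (xs ++ ys)))
      ≡⟨ mean-cong n rest (λ ys → trans (mean-return n (xs ++ ys) lengthℚ)
           (trans (cong ι (List.length-++ xs)) (ι-+ (length xs) (length ys)))) ⟩
    mean n rest (λ ys → lengthℚ xs ℚ.+ lengthℚ ys)
      ≡⟨ mean-+ n rest (λ _ → lengthℚ xs) lengthℚ ⟩
    mean n rest (λ _ → lengthℚ xs) ℚ.+ meanLength n rest
      ≡⟨ cong₂ ℚ._+_ (mean-const n rest (normalised-independently n hs) (lengthℚ xs))
                     (meanLength-independently n hs) ⟩
    lengthℚ xs ℚ.+ s ∎

-- The two weights are complementary term by term, whatever rational approximates the probability.
normalised-emit : ∀ n (a : A) q → Normalised n (emit a withProbability q)
normalised-emit n a q =
  solve 1 (λ q → q :* con 1ℚ :+ ((con 1ℚ :- q) :* con 1ℚ :+ con 0ℚ) := con 1ℚ) refl (seq q n)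
  where open ℚ-Solver

meanLength-emit : ∀ n (a : A) q → meanLength n (emit a withProbability q) ≡ seq q n
meanLength-emit n a q =
  solve 1 (λ q → q :* con 1ℚ :+ ((con 1ℚ :- q) :* con 0ℚ :+ con 0ℚ) := q) refl (seq q n)
  where open ℚ-Solver

-- Square roots

recipℚ-nonNeg : ∀ {q} → 0ℚ ℚ.< q → 0ℚ ℚ.≤ recipℚ q
recipℚ-nonNeg q>0 = ℚ.<⇒≤ (proj₁ (recipℚ-inverse q>0))

-- If `r` is the rounded root, then `K² ≤ (m+1)K² < (r+1)²`.
K≤⌊√mKK⌋ : ∀ m K → K ≤ ⌊√ suc m * (K * K) ⌋
K≤⌊√mKK⌋ m K = ℕ.s≤s⁻¹ (square-cancel-<
  (ℕ.≤-<-trans (ℕ.m≤m+n (K * K) _) (⌊√⌋-upper (suc m * (K * K)))))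

√-seq-≥1 : ∀ m n → 1ℚ ℚ.≤ √-seq (suc m) n
√-seq-≥1 m n = /-mono-≤ 1 1 ⌊√ suc m * (suc n * suc n) ⌋ (suc n)
  (ℕ.≤-trans (ℕ.≤-reflexive (ℕ.*-identityˡ (suc n)))
    (ℕ.≤-trans (K≤⌊√mKK⌋ m (suc n)) (ℕ.≤-reflexive (sym (ℕ.*-identityʳ _)))))

-- Hence `recipℚ` never takes its default value 0 on the approximants of a root of a positive
-- number.
√-seq-pos : ∀ m n → 0ℚ ℚ.< √-seq (suc m) n
√-seq-pos m n = ℚ.<-≤-trans (ℚ.positive⁻¹ 1ℚ) (√-seq-≥1 m n)

-- With `r` the integer root of `MK²`, `MK² ≤ r² + 2r`, and `2 ≤ K ≤ r` gives `2r ≤ r²`. The factor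
-- 2 thus pays for rounding down. Index 0 must be excluded: there `K = 1`, and `√ 3` is approximated
-- by 1, whereas `3 ≤ 1 + 1` fails.
√-seq-square-lower : ∀ m n → 1 ≤ n →
  ι (suc m) ℚ.≤ √-seq (suc m) n ℚ.* √-seq (suc m) n ℚ.+ √-seq (suc m) n ℚ.* √-seq (suc m) n
√-seq-square-lower m n 1≤n = begin
  ι M
    ≤⟨ /-mono-≤ M 1 (r * r ℕ.+ r * r) (K * K) (ℕ.≤-trans bound (ℕ.≤-reflexive (sym (ℕ.*-identityʳ _)))) ⟩
  (+ (r * r ℕ.+ r * r)) / (K * K)
    ≡⟨ /-+-same (r * r) (r * r) (K * K) ⟨
  (+ (r * r)) / (K * K) ℚ.+ (+ (r * r)) / (K * K)
    ≡⟨ cong₂ ℚ._+_ (/-* r K r K) (/-* r K r K) ⟨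
  s ℚ.* s ℚ.+ s ℚ.* s ∎
  where
  open ℚ.≤-Reasoning
  M = suc m
  K = suc n
  r = ⌊√ M * (K * K) ⌋
  s = √-seq M n
  bound : M * (K * K) ≤ r * r ℕ.+ r * r
  bound = ℕ.≤-trans (ℕ.s≤s⁻¹ (⌊√⌋-upper (M * (K * K)))) (ℕ.≤-trans
    (ℕ.≤-reflexive (solve 1 (λ r → r :+ r :* (con 1 :+ r) := r :* r :+ con 2 :* r) refl r))
    (ℕ.+-monoʳ-≤ (r * r) (ℕ.*-monoˡ-≤ r (ℕ.≤-trans (s≤s 1≤n) (K≤⌊√mKK⌋ m K)))))
    where open +-*-Solver

-- With the value 0 at m = 0, as in 1/√_.
1/₀ : ℕ → ℚ
1/₀ zero    = 0ℚ
1/₀ (suc m) = 1/suc m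

0≤1/₀ : ∀ m → 0ℚ ℚ.≤ 1/₀ m
0≤1/₀ zero    = ℚ.≤-refl
0≤1/₀ (suc m) = 0≤1/suc m

ι*1/suc : ∀ m → ι (suc m) ℚ.* 1/suc m ≡ 1ℚ
ι*1/suc m = trans (/-* (suc m) 1 1 (suc m)) (ℚ.≤-antisym
  (/-mono-≤ (suc m * 1) (1 * suc m) 1 1 (ℕ.≤-reflexive (swap (suc m))))
  (/-mono-≤ 1 1 (suc m * 1) (1 * suc m) (ℕ.≤-reflexive (sym (swap (suc m))))))
  where
  open +-*-Solver
  swap : ∀ k → k * 1 * 1 ≡ 1 * (1 * k)
  swap = solve 1 (λ k → k :* con 1 :* con 1 := con 1 :* (con 1 :* k)) refl

-- An inequality, since a word that occurs in no document has product 0.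
ι*1/₀≤1 : ∀ m → ι m ℚ.* 1/₀ m ℚ.≤ 1ℚ
ι*1/₀≤1 zero    = 0≤ι 1
ι*1/₀≤1 (suc m) = ℚ.≤-reflexive (ι*1/suc m)

-- The approximants of √ m are rounded down, so those of 1/√ m are too large:
-- their squares exceed 1/m.
1/√-square-upper : ∀ m n → 1 ≤ n → seq (1/√ m) n ℚ.* seq (1/√ m) n ℚ.≤ 1/₀ m ℚ.+ 1/₀ m
1/√-square-upper zero    n 1≤n = ℚ.≤-refl
1/√-square-upper (suc m) n 1≤n = begin
  x ℚ.* x
    ≡⟨ trans (cong (x ℚ.* x ℚ.*_) (ι*1/suc m)) (ℚ.*-identityʳ _) ⟨
  x ℚ.* x ℚ.* (ι (suc m) ℚ.* v)
    ≤⟨ *-mono-≤ˡ (0≤p*p x) (*-mono-≤ʳ (0≤1/suc m) (√-seq-square-lower m n 1≤n)) ⟩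
  x ℚ.* x ℚ.* ((s ℚ.* s ℚ.+ s ℚ.* s) ℚ.* v)
    ≡⟨ solve 3 (λ x s v → x :* x :* ((s :* s :+ s :* s) :* v)
                       := (x :* s) :* (x :* s) :* (v :+ v)) refl x s v ⟩
  (x ℚ.* s) ℚ.* (x ℚ.* s) ℚ.* (v ℚ.+ v)
    ≡⟨ cong (λ z → z ℚ.* z ℚ.* (v ℚ.+ v)) (proj₂ (recipℚ-inverse (√-seq-pos m n))) ⟩
  1ℚ ℚ.* 1ℚ ℚ.* (v ℚ.+ v)
    ≡⟨ ℚ.*-identityˡ (v ℚ.+ v) ⟩
  v ℚ.+ v ∎
  where
  open ℚ.≤-Reasoning
  open ℚ-Solver
  x = seq (1/√ suc m) n
  s = √-seq (suc m) n
  v = 1/suc m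

0≤log-seq : ∀ D n → 0ℚ ℚ.≤ log-seq D n
-- Any denominator at least `c + suc n` bounds all the terms; one more makes it visibly nonzero.
0≤log-seq D n = ℚ.≤-trans (/-mono-≤ 0 1 c (suc c ℕ.+ suc n) z≤n)
  (harmonic-lower (suc n) c (suc c ℕ.+ suc n) (ℕ.n≤1+n _))
  where c = (D ℕ.∸ 1) * suc n

-- Charging each pair to its two words

-- Split the charge of each pair into its two halves and rename the second so that both charge
-- `a i`. For fixed `i` in `t`, each partner `j` in `t` is then met at most once, and there are at
-- most `∣ t ∣` partners.
∑-pairsIn : ∀ {D} (t : Subset D) (a : Word D → ℚ) → (∀ i → 0ℚ ℚ.≤ a i) →
  ∑ (pairsIn t) (λ (i , j) → a i ℚ.+ a j) ℚ.≤ ι ∣ t ∣ ℚ.* ∑ (allFin D) (λ i → 𝟙 (i ∈? t) ℚ.* a i)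
∑-pairsIn {D} t a 0≤a = begin
  ∑ (pairsIn t) (λ (i , j) → a i ℚ.+ a j)
    ≡⟨ ∑-filter _ (cartesianProduct ws ws) _ ⟩
  ∑ (cartesianProduct ws ws) (λ (i , j) → 𝟙 (i Fin.<? j ×-dec (i ∈? t ×-dec j ∈? t)) ℚ.* (a i ℚ.+ a j))
    ≡⟨ ∑-cartesianProduct ws ws _ ⟩
  ∑ ws (λ i → ∑ ws (λ j → 𝟙 (i Fin.<? j ×-dec (i ∈? t ×-dec j ∈? t)) ℚ.* (a i ℚ.+ a j)))
    ≡⟨ ∑-cong ws (λ i → trans (∑-cong ws (split i)) (∑-+ ws _ _)) ⟩
  ∑ ws (λ i → ∑ ws (F i) ℚ.+ ∑ ws (G i))
    ≡⟨ ∑-+ ws _ _ ⟩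
  ∑ ws (λ i → ∑ ws (F i)) ℚ.+ ∑ ws (λ i → ∑ ws (G i))
    -- Exchanging the summations renames the variables of `G`, turning its charge `a j` into `a i`.
    ≡⟨ cong (∑ ws (λ i → ∑ ws (F i)) ℚ.+_) (∑-swap ws ws G) ⟩
  ∑ ws (λ i → ∑ ws (F i)) ℚ.+ ∑ ws (λ i → ∑ ws (λ j → G j i))
    ≡⟨ ∑-+ ws _ _ ⟨
  ∑ ws (λ i → ∑ ws (F i) ℚ.+ ∑ ws (λ j → G j i))
    ≡⟨ ∑-cong ws (λ i → ∑-+ ws _ _) ⟨
  ∑ ws (λ i → ∑ ws (λ j → F i j ℚ.+ G j i))
    ≤⟨ ∑-mono ws (λ i → ∑-mono ws (merge i)) ⟩
  ∑ ws (λ i → ∑ ws (λ j → χ i ℚ.* a i ℚ.* χ j))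
    ≡⟨ ∑-cong ws (λ i → trans (∑-*ˡ ws (χ i ℚ.* a i) χ) (cong (χ i ℚ.* a i ℚ.*_) (∑-∣∣ t))) ⟩
  ∑ ws (λ i → χ i ℚ.* a i ℚ.* ι ∣ t ∣)
    ≡⟨ trans (∑-*ʳ ws _ _) (ℚ.*-comm _ (ι ∣ t ∣)) ⟩
  ι ∣ t ∣ ℚ.* ∑ ws (λ i → χ i ℚ.* a i) ∎
  where
  open ℚ.≤-Reasoning
  open ℚ-Solver
  ws = allFin D
  χ : Word D → ℚ
  χ i = 𝟙 (i ∈? t)
  F G : Word D → Word D → ℚ
  F i j = 𝟙 (i Fin.<? j) ℚ.* (χ i ℚ.* a i ℚ.* χ j)
  G i j = 𝟙 (i Fin.<? j) ℚ.* (χ j ℚ.* a j ℚ.* χ i)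
  split : ∀ i j → 𝟙 (i Fin.<? j ×-dec (i ∈? t ×-dec j ∈? t)) ℚ.* (a i ℚ.+ a j) ≡ F i j ℚ.+ G i j
  split i j = trans
    (cong (ℚ._* (a i ℚ.+ a j)) (trans (𝟙-× (i Fin.<? j) (i ∈? t ×-dec j ∈? t))
      (cong (𝟙 (i Fin.<? j) ℚ.*_) (𝟙-× (i ∈? t) (j ∈? t)))))
    (solve 5 (λ l x y a b → (l :* (x :* y)) :* (a :+ b)
                         := l :* (x :* a :* y) :+ l :* (y :* b :* x)) refl
      (𝟙 (i Fin.<? j)) (χ i) (χ j) (a i) (a j))
  -- At most one of `i < j` and `j < i` holds. On the diagonal the left side is 0, and the right
  -- side is nonnegative because `a` is.
  merge : ∀ i j → F i j ℚ.+ G j i ℚ.≤ χ i ℚ.* a i ℚ.* χ j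
  merge i j = begin
    F i j ℚ.+ G j i
      ≡⟨ ℚ.*-distribʳ-+ (χ i ℚ.* a i ℚ.* χ j) (𝟙 (i Fin.<? j)) (𝟙 (j Fin.<? i)) ⟨
    (𝟙 (i Fin.<? j) ℚ.+ 𝟙 (j Fin.<? i)) ℚ.* (χ i ℚ.* a i ℚ.* χ j)
      ≤⟨ *-mono-≤ʳ (0≤*0≤ (0≤*0≤ (0≤𝟙 (i ∈? t)) (0≤a i)) (0≤𝟙 (j ∈? t)))
                  (𝟙+𝟙≤1 (i Fin.<? j) (j Fin.<? i) Fin.<-asym) ⟩
    1ℚ ℚ.* (χ i ℚ.* a i ℚ.* χ j)
      ≡⟨ ℚ.*-identityˡ _ ⟩
    χ i ℚ.* a i ℚ.* χ j ∎

∑-nonNeg : ∀ (xs : List A) {f} → (∀ x → 0ℚ ℚ.≤ f x) → 0ℚ ℚ.≤ ∑ xs f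
∑-nonNeg xs 0≤f = ℚ.≤-trans (ℚ.≤-reflexive (sym (∑-0 xs))) (∑-mono xs 0≤f)

-- Double counting: a document charges each of its words `i` at most `L/#(i)`, and exactly `#(i)`
-- documents contain `i`, so each word receives at most `L` in total. This is where the number of
-- documents cancels.
∑∑-pairsIn : ∀ {D N L} (T : Corpus D N) → AtMost L WordsPerDocument T →
  ∑ (Vec.toList T) (λ t → ∑ (pairsIn t) (λ (i , j) → 1/₀ (#₁ T i) ℚ.+ 1/₀ (#₁ T j))) ℚ.≤ ι L ℚ.* ι D
∑∑-pairsIn {D} {N} {L} T atMost = begin
  ∑ ts (λ t → ∑ (pairsIn t) (λ (i , j) → a i ℚ.+ a j))
    ≤⟨ ∑-mono ts (λ t → ∑-pairsIn t a 0≤a) ⟩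
  ∑ ts (λ t → ι ∣ t ∣ ℚ.* ∑ ws (λ i → 𝟙 (i ∈? t) ℚ.* a i))
    ≤⟨ ∑-mono-All (All.map (λ {t} ∣t∣≤L →
         *-mono-≤ʳ (∑-nonNeg ws (λ i → 0≤*0≤ (0≤𝟙 (i ∈? t)) (0≤a i))) (ι-mono ∣t∣≤L)) (toList⁺ atMost)) ⟩
  ∑ ts (λ t → ι L ℚ.* ∑ ws (λ i → 𝟙 (i ∈? t) ℚ.* a i))
    ≡⟨ trans (∑-*ˡ ts (ι L) _) (cong (ι L ℚ.*_) (∑-swap ts ws _)) ⟩
  ι L ℚ.* ∑ ws (λ i → ∑ ts (λ t → 𝟙 (i ∈? t) ℚ.* a i))
    ≡⟨ cong (ι L ℚ.*_) (∑-cong ws (λ i →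
         trans (∑-*ʳ ts (a i) _) (cong (ℚ._* a i) (∑-count (i ∈?_) T)))) ⟩
  ι L ℚ.* ∑ ws (λ i → ι (#₁ T i) ℚ.* a i)
    ≤⟨ *-mono-≤ˡ (0≤ι L) (∑-mono ws (λ i → ι*1/₀≤1 (#₁ T i))) ⟩
  ι L ℚ.* ∑ ws (λ _ → 1ℚ)
    ≡⟨ cong (ι L ℚ.*_) (trans (∑-1 ws) (cong ι (List.length-tabulate {n = D} (λ i → i)))) ⟩
  ι L ℚ.* ι D ∎
  where
  open ℚ.≤-Reasoning
  ts = Vec.toList T
  ws = allFin D
  a : Word D → ℚ
  a i = 1/₀ (#₁ T i)
  0≤a : ∀ i → 0ℚ ℚ.≤ a i
  0≤a i = 0≤1/₀ (#₁ T i)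

-- The expected shuffle size: from approximants to reals.

eventually-≤⇒≤ᵣ : ∀ x y N → (∀ n → N ≤ n → seq x n ℚ.≤ seq y n) → x ≤ᵣ y
eventually-≤⇒≤ᵣ x y N h η η>0 = N , λ n N≤n → begin
  seq x n          ≤⟨ h n N≤n ⟩
  seq y n          ≡⟨ ℚ.+-identityʳ _ ⟨
  seq y n ℚ.+ 0ℚ   ≤⟨ ℚ.+-monoʳ-≤ (seq y n) (ℚ.<⇒≤ η>0) ⟩
  seq y n ℚ.+ η    ∎
  where open ℚ.≤-Reasoning

-- From the index in the positivity witness on, the terms of `ε` are at least `δ`; earlier terms may
-- be negative, and so may their reciprocals.
⁻¹-eventually-nonNeg : ∀ ε (ε>0 : 0ᵣ <ᵣ ε) →
  ∃[ N ] ∀ n → N ≤ n → 0ℚ ℚ.≤ seq (ε ⁻¹⟨ ε>0 ⟩) n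
⁻¹-eventually-nonNeg ε (δ , δ>0 , N , δ≤) = N , λ n N≤n →
  recipℚ-nonNeg (ℚ.<-≤-trans δ>0 (subst (ℚ._≤ seq ε n) (ℚ.+-identityˡ δ) (δ≤ n N≤n)))

module _ (p ε : ℝ) (ε>0 : 0ᵣ <ᵣ ε) {D N : ℕ} (T : Corpus D N) where
  open CosineSampleEmit p ε ε>0 T

  private
    emitter : Word D × Word D → Dist (List (KeyValue D))
    emitter (i , j) = emit ((i , j) , 1) withProbability emitProbability i j

    emitters-normalised : ∀ n ijs → All (Normalised n) (map emitter ijs)
    emitters-normalised n []               = []
    emitters-normalised n ((i , j) ∷ ijs) =
      normalised-emit n ((i , j) , 1) (emitProbability i j) ∷ emitters-normalised n ijs

    mappers-normalised : ∀ n ts → All (Normalised n) (map mapper ts)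
    mappers-normalised n []       = []
    mappers-normalised n (t ∷ ts) =
      normalised-independently n (emitters-normalised n (pairsIn t)) ∷ mappers-normalised n ts

  -- Linearity of expectation is applied twice, over documents and then over the pairs of one
  -- document, giving an exact identity at each index.
  meanLength-shuffle : ∀ n → meanLength n shuffle ≡
    ∑ (Vec.toList T) (λ t → ∑ (pairsIn t) (λ (i , j) → seq (emitProbability i j) n))
  meanLength-shuffle n = trans (meanLength-independently n (mappers-normalised n ts))
    (trans (∑-map mapper ts (meanLength n)) (∑-cong ts λ t →
      trans (meanLength-independently n (emitters-normalised n (pairsIn t)))
        (trans (∑-map emitter (pairsIn t) (meanLength n))
          (∑-cong (pairsIn t) λ (i , j) → meanLength-emit n ((i , j) , 1) (emitProbability i j)))))
    where ts = Vec.toList T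

  emitProbability-bound : ∀ n i j → 1 ≤ n → 0ℚ ℚ.≤ seq p/ε n →
    seq (emitProbability i j) n ℚ.≤ seq p/ε n ℚ.* (1/₀ (#₁ T i) ℚ.+ 1/₀ (#₁ T j))
  emitProbability-bound n i j 1≤n 0≤c = begin
    1ℚ ℚ.⊓ (c ℚ.* (x ℚ.* y))
      -- The cap at 1 is dropped; AM-GM then separates the two words.
      ≤⟨ ℚ.p⊓q≤q 1ℚ (c ℚ.* (x ℚ.* y)) ⟩
    c ℚ.* (x ℚ.* y)
      ≤⟨ *-mono-≤ˡ 0≤c (p*q≤a+b {x} {y} {1/₀ (#₁ T i)} {1/₀ (#₁ T j)}
                            (1/√-square-upper (#₁ T i) n 1≤n)
                            (1/√-square-upper (#₁ T j) n 1≤n)) ⟩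
    c ℚ.* (1/₀ (#₁ T i) ℚ.+ 1/₀ (#₁ T j)) ∎
    where
    open ℚ.≤-Reasoning
    c = seq p/ε n
    x = seq (1/√ #₁ T i) n
    y = seq (1/√ #₁ T j) n

  meanLength-shuffle-bound : ∀ {L} n → AtMost L WordsPerDocument T → 1 ≤ n → 0ℚ ℚ.≤ seq p/ε n →
    meanLength n shuffle ℚ.≤ seq p/ε n ℚ.* ι L ℚ.* ι D
  meanLength-shuffle-bound {L} n atMost 1≤n 0≤c = begin
    meanLength n shuffle
      ≡⟨ meanLength-shuffle n ⟩
    ∑ ts (λ t → ∑ (pairsIn t) (λ (i , j) → seq (emitProbability i j) n))
      ≤⟨ ∑-mono ts (λ t → ∑-mono (pairsIn t) (λ (i , j) → emitProbability-bound n i j 1≤n 0≤c)) ⟩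
    ∑ ts (λ t → ∑ (pairsIn t) (λ (i , j) → c ℚ.* (1/₀ (#₁ T i) ℚ.+ 1/₀ (#₁ T j))))
      ≡⟨ trans (∑-cong ts (λ t → ∑-*ˡ (pairsIn t) c _)) (∑-*ˡ ts c _) ⟩
    c ℚ.* ∑ ts (λ t → ∑ (pairsIn t) (λ (i , j) → 1/₀ (#₁ T i) ℚ.+ 1/₀ (#₁ T j)))
      ≤⟨ *-mono-≤ˡ 0≤c (∑∑-pairsIn T atMost) ⟩
    c ℚ.* (ι L ℚ.* ι D)
      ≡⟨ ℚ.*-assoc c (ι L) (ι D) ⟨
    c ℚ.* ι L ℚ.* ι D ∎
    where
    open ℚ.≤-Reasoning
    ts = Vec.toList T
    c = seq p/ε n

expected-shuffle-size : ∀ {D L N} (T : Corpus D N) p ε ε>0 → (∀ n → 0ℚ ℚ.≤ seq p n) →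
  AtMost L WordsPerDocument T →
  𝔼 (CosineSampleEmit.shuffle p ε ε>0 T) (λ out → fromℕ (length out))
    ≤ᵣ (p *ᵣ ε ⁻¹⟨ ε>0 ⟩) *ᵣ fromℕ L *ᵣ fromℕ D
expected-shuffle-size {D} {L} T p ε ε>0 0≤p atMost =
  let N₀ , 0≤ε⁻¹ = ⁻¹-eventually-nonNeg ε ε>0
  in eventually-≤⇒≤ᵣ (𝔼 shuffle (λ out → fromℕ (length out)))
      -- Index 1 starts the square root estimate, and `N₀` the nonnegativity of the approximants of
      -- `1/ε`.
      (p/ε *ᵣ fromℕ L *ᵣ fromℕ D) (1 ℕ.⊔ N₀) λ n N≤n →
    ℚ.≤-trans (ℚ.≤-reflexive (seq-𝔼 n shuffle (λ out → fromℕ (length out))))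
      (meanLength-shuffle-bound p ε ε>0 T n atMost (ℕ.m⊔n≤o⇒m≤o 1 N₀ N≤n)
        (0≤*0≤ (0≤p n) (0≤ε⁻¹ n (ℕ.m⊔n≤o⇒n≤o 1 N₀ N≤n))))
  where open CosineSampleEmit p ε ε>0 T

-- Both sides are the same product at every index. The factor 2 of `p` becomes the constant of the
-- O-bound.
bound-rearranged : ∀ D L (l e : ℝ) →
  (fromℕ 2 *ᵣ l *ᵣ e) *ᵣ fromℕ L *ᵣ fromℕ D ≤ᵣ fromℕ 2 *ᵣ (fromℕ D *ᵣ fromℕ L *ᵣ l *ᵣ e)
bound-rearranged D L l e = eventually-≤⇒≤ᵣ ((fromℕ 2 *ᵣ l *ᵣ e) *ᵣ fromℕ L *ᵣ fromℕ D)
  (fromℕ 2 *ᵣ (fromℕ D *ᵣ fromℕ L *ᵣ l *ᵣ e)) 0 λ n _ → ℚ.≤-reflexive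
  (solve 5 (λ c l e x y → (c :* l :* e) :* x :* y := c :* (y :* x :* l :* e)) refl
    (ι 2) (seq l n) (seq e n) (ι L) (ι D))
  where open ℚ-Solver

0≤2log : ∀ D n → 0ℚ ℚ.≤ seq (fromℕ 2 *ᵣ log D) n
0≤2log D n = 0≤*0≤ (0≤ι 2) (0≤log-seq D n)

-- Counting unordered pairs in an output list.

lookup-injective : ∀ {xs : List A} → Unique xs → ∀ i j → lookup xs i ≡ lookup xs j → i ≡ j
lookup-injective (x∉xs ∷ xs!) zero    zero    eq = refl
lookup-injective (x∉xs ∷ xs!) zero    (suc j) eq = contradiction eq (All.lookup x∉xs (∈-lookup j))
lookup-injective (x∉xs ∷ xs!) (suc i) zero    eq = contradiction (sym eq) (All.lookup x∉xs (∈-lookup i))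
lookup-injective (x∉xs ∷ xs!) (suc i) (suc j) eq = cong suc (lookup-injective xs! i j eq)

-- Pigeonhole: sending each position in `xs` to a position of the same element in `ys` is injective,
-- as the entries of `xs` are distinct.
unique-⊆⇒length-≤ : ∀ {xs ys : List A} → Unique xs → (∀ {x} → x ∈ xs → x ∈ ys) → length xs ≤ length ys
unique-⊆⇒length-≤ {xs = xs} {ys} xs! xs⊆ys = Fin.injective⇒≤ {f = position} λ {i} {j} eq →
  lookup-injective xs! i j (trans (lookup-index (member i))
    (trans (cong (lookup ys) eq) (sym (lookup-index (member j)))))
  where
  member : ∀ i → lookup xs i ∈ ys
  member i = xs⊆ys (∈-lookup i)
  position : Fin (length xs) → Fin (length ys)
  position i = Any.index (member i)

ordered : ∀ {n} → Fin n × Fin n → Fin n × Fin n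
ordered (x , y) = if does (x Fin.<? y) then (x , y) else (y , x)

ordered-< : ∀ {n} {x y : Fin n} → x < y → ordered (x , y) ≡ (x , y)
ordered-< {x = x} {y} x<y = cong (if_then (x , y) else (y , x)) (dec-true (x Fin.<? y) x<y)

ordered-> : ∀ {n} {x y : Fin n} → x < y → ordered (y , x) ≡ (x , y)
ordered-> {x = x} {y} x<y =
  cong (if_then (y , x) else (x , y)) (dec-false (y Fin.<? x) (Fin.<-asym x<y))

-- The output may list a pair in either orientation. Normalising every entry with `ordered` keeps
-- the length and yields a list that contains all of `ps`.
unordered-⊆⇒length-≤ : ∀ {n} {ps out : List (Fin n × Fin n)} → Unique ps →
  All (λ (x , y) → x < y) ps →
  (∀ {x y} → (x , y) ∈ ps → (x , y) ∈ out ⊎ (y , x) ∈ out) → length ps ≤ length out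
unordered-⊆⇒length-≤ {ps = ps} {out} ps! ps< ps⊆ =
  ℕ.≤-trans (unique-⊆⇒length-≤ ps! ps⊆ordered) (ℕ.≤-reflexive (List.length-map ordered out))
  where
  ps⊆ordered : ∀ {xy} → xy ∈ ps → xy ∈ map ordered out
  ps⊆ordered {x , y} xy∈ps with ps⊆ xy∈ps
  ... | inj₁ xy∈out = subst (_∈ map ordered out) (ordered-< (All.lookup ps< xy∈ps)) (∈-map⁺ ordered xy∈out)
  ... | inj₂ yx∈out = subst (_∈ map ordered out) (ordered-> (All.lookup ps< xy∈ps)) (∈-map⁺ ordered yx∈out)

-- Pairs within one block and binomial estimates.

increasingPairs : ∀ n → List (Fin n × Fin n)
increasingPairs zero    = []
increasingPairs (suc n) = map (λ j → zero , suc j) (allFin n)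
                       ++ map (λ (i , j) → suc i , suc j) (increasingPairs n)

-- The recursion separates the pairs that begin with `zero`, so the lengths follow Pascal's rule.
length-increasingPairs : ∀ n → length (increasingPairs n) ≡ n C 2
length-increasingPairs zero    = refl
length-increasingPairs (suc n) = begin
  length (increasingPairs (suc n))
    ≡⟨ List.length-++ (map (λ j → zero , suc j) (allFin n)) ⟩
  length (map (λ j → zero {n} , suc j) (allFin n))
    ℕ.+ length (map (λ (i , j) → suc i , suc j) (increasingPairs n))
    ≡⟨ cong₂ ℕ._+_ (trans (List.length-map _ (allFin n)) (List.length-tabulate {n = n} (λ i → i)))
                   (trans (List.length-map _ (increasingPairs n)) (length-increasingPairs n)) ⟩
  n ℕ.+ n C 2
    ≡⟨ cong (ℕ._+ n C 2) (nC1≡n n) ⟨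
  n C 1 ℕ.+ n C 2
    ≡⟨ nCk+nC[k+1]≡[n+1]C[k+1] n 1 ⟩
  suc n C 2 ∎
  where open ≡-Reasoning

increasingPairs-unique : ∀ n → Unique (increasingPairs n)
increasingPairs-unique zero    = []
increasingPairs-unique (suc n) = Unique.++⁺
  (Unique.map⁺ (λ { refl → refl }) (Unique.allFin⁺ n))
  (Unique.map⁺ (λ { refl → refl }) (increasingPairs-unique n))
  λ (∈l , ∈r) → disjoint (∈-map⁻ _ ∈l) (∈-map⁻ _ ∈r)
  where
  disjoint : ∀ {ij} → (∃[ j ] j ∈ allFin n × ij ≡ (zero , suc j)) →
             ¬ (∃[ kl ] kl ∈ increasingPairs n × ij ≡ (suc (proj₁ kl) , suc (proj₂ kl)))
  disjoint (_ , _ , refl) (_ , _ , ())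

increasingPairs-< : ∀ n → All (λ (i , j) → i < j) (increasingPairs n)
increasingPairs-< zero    = []
increasingPairs-< (suc n) = All.++⁺
  (All.map⁺ (All.universal (λ _ → s≤s z≤n) (allFin n)))
  (All.map⁺ (All.map s≤s (increasingPairs-< n)))

2*[1+n]C2 : ∀ n → 2 * (suc n C 2) ≡ suc n * n
2*[1+n]C2 zero    = refl
2*[1+n]C2 (suc n) = begin
  2 * (suc (suc n) C 2)                ≡⟨ cong (2 *_) (nCk+nC[k+1]≡[n+1]C[k+1] (suc n) 1) ⟨
  2 * (suc n C 1 ℕ.+ suc n C 2)        ≡⟨ ℕ.*-distribˡ-+ 2 (suc n C 1) (suc n C 2) ⟩
  2 * (suc n C 1) ℕ.+ 2 * (suc n C 2)  ≡⟨ cong₂ ℕ._+_ (cong (2 *_) (nC1≡n (suc n))) (2*[1+n]C2 n) ⟩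
  2 * suc n ℕ.+ suc n * n              ≡⟨ solve 1 (λ n → con 2 :* (con 1 :+ n) :+ (con 1 :+ n) :* n
                                            := (con 2 :+ n) :* (con 1 :+ n)) refl n ⟩
  suc (suc n) * suc n                  ∎
  where
  open ≡-Reasoning
  open +-*-Solver

-- `4 C(n,2) = 2n(n-1)`, and `n ≤ 2(n-1)` once `n ≥ 2`. Equality at `n = 2` shows that 4 is the best
-- constant.
n*n≤4*nC2 : ∀ n → 2 ≤ n → n * n ≤ 4 * (n C 2)
n*n≤4*nC2 n@(suc m) (s≤s 1≤m) = begin
  n * n                  ≤⟨ ℕ.*-monoʳ-≤ n (ℕ.+-monoˡ-≤ m 1≤m) ⟩
  n * (m ℕ.+ m)          ≡⟨ solve 2 (λ n m → n :* (m :+ m) := con 2 :* (n :* m)) refl n m ⟩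
  2 * (n * m)            ≡⟨ cong (2 *_) (2*[1+n]C2 m) ⟨
  2 * (2 * (n C 2))      ≡⟨ ℕ.*-assoc 2 2 (n C 2) ⟨
  4 * (n C 2)            ∎
  where
  open ℕ.≤-Reasoning
  open +-*-Solver

q*L*L≤4*[q*LC2] : ∀ q L → 2 ≤ L → q * L * L ≤ 4 * (q * (L C 2))
q*L*L≤4*[q*LC2] q L 2≤L = begin
  q * L * L            ≡⟨ ℕ.*-assoc q L L ⟩
  q * (L * L)          ≤⟨ ℕ.*-monoʳ-≤ q (n*n≤4*nC2 L 2≤L) ⟩
  q * (4 * (L C 2))    ≡⟨ solve 2 (λ q c → q :* (con 4 :* c) := con 4 :* (q :* c)) refl q (L C 2) ⟩
  4 * (q * (L C 2))    ∎
  where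
  open ℕ.≤-Reasoning
  open +-*-Solver

-- The block corpus

length-cartesianProductWith : ∀ {C : Set} (f : A → B → C) xs ys →
  length (cartesianProductWith f xs ys) ≡ length xs * length ys
length-cartesianProductWith f []       ys = refl
length-cartesianProductWith f (x ∷ xs) ys = trans (List.length-++ (map (f x) ys))
  (cong₂ ℕ._+_ (List.length-map (f x) ys) (length-cartesianProductWith f xs ys))

∣++∣ : ∀ {m n} (s : Subset m) (t : Subset n) → ∣ s Vec.++ t ∣ ≡ ∣ s ∣ ℕ.+ ∣ t ∣
∣++∣ []            t = refl
∣++∣ (inside  ∷ s) t = cong suc (∣++∣ s t)
∣++∣ (outside ∷ s) t = ∣++∣ s t

count-tabulate-none : ∀ {P : A → Set} (P? : Decidable P) {n} (f : Fin n → A) →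
  (∀ i → ¬ P (f i)) → Vec.count P? (Vec.tabulate f) ≡ 0
count-tabulate-none P? {zero}  f ¬P = refl
count-tabulate-none P? {suc n} f ¬P with P? (f zero)
... | yes p = contradiction p (¬P zero)
... | no  _ = count-tabulate-none P? (f ∘ suc) (¬P ∘ suc)

count-tabulate-unique : ∀ {P : A → Set} (P? : Decidable P) {n} (f : Fin n → A) k →
  P (f k) → (∀ i → P (f i) → k ≡ i) → Vec.count P? (Vec.tabulate f) ≡ 1
count-tabulate-unique P? f zero    p unique with P? (f zero)
... | no ¬p = contradiction p ¬p
... | yes _ = cong suc (count-tabulate-none P? (f ∘ suc) λ i q → Fin.0≢1+n (unique (suc i) q))
count-tabulate-unique P? f (suc k) p unique with P? (f zero)
... | yes q = contradiction (sym (unique zero q)) Fin.0≢1+n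
... | no  _ = count-tabulate-unique P? (f ∘ suc) k p (λ i → Fin.suc-injective ∘ unique (suc i))

⌊√k*k⌋ : ∀ k → ⌊√ k * k ⌋ ≡ k
⌊√k*k⌋ k = ℕ.≤-antisym
  (ℕ.≮⇒≥ λ k<r → ℕ.<⇒≱ (ℕ.*-mono-< k<r k<r) (⌊√⌋-lower (k * k)))
  (ℕ.s≤s⁻¹ (square-cancel-< (⌊√⌋-upper (k * k))))

-- The radicand is the perfect square `(n+1)²`, so nothing is lost to rounding, and the similarities
-- in the block corpus equal 1 at every index.
√1-seq : ∀ n → √-seq 1 n ≡ 1ℚ
√1-seq n = trans (cong (λ r → (+ r) / suc n)
                         (trans (cong ⌊√_⌋ (ℕ.*-identityˡ (suc n * suc n))) (⌊√k*k⌋ (suc n))))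
  (ℚ.≤-antisym (/-mono-≤ (suc n) (suc n) 1 1 (ℕ.≤-reflexive (ℕ.*-comm (suc n) 1)))
               (/-mono-≤ 1 1 (suc n) (suc n) (ℕ.≤-reflexive (ℕ.*-comm 1 (suc n)))))

1/√1 : ∀ n → seq (1/√ 1) n ≡ 1ℚ
1/√1 n = cong recipℚ (√1-seq n)

module _ (L : ℕ) where

  -- The recursion follows `suc q * L = L + q * L`, as `combine` does, so block `k` consists of the
  -- words `combine k i`.
  block : ∀ {q} → Fin q → Subset (q * L)
  block {suc q} zero    = Subset.⊤ {L} Vec.++ Subset.⊥ {q * L}
  block {suc q} (suc k) = Subset.⊥ {L} Vec.++ block k

  ∣block∣ : ∀ {q} (k : Fin q) → ∣ block k ∣ ≡ L
  ∣block∣ {suc q} zero    = trans (∣++∣ (Subset.⊤ {L}) _)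
    (trans (cong₂ ℕ._+_ (∣⊤∣≡n L) (∣⊥∣≡0 (q * L))) (ℕ.+-identityʳ L))
  ∣block∣ {suc q} (suc k) = trans (∣++∣ (Subset.⊥ {L}) _)
    (cong₂ ℕ._+_ (∣⊥∣≡0 L) (∣block∣ k))

  combine∈block : ∀ {q} (k : Fin q) (i : Fin L) → combine k i Subset.∈ block k
  combine∈block {suc q} zero    i = Vec.lookup⇒[]= _ _
    (trans (Vec.lookup-++ˡ (Subset.⊤ {L}) _ i) (Vec.lookup-replicate i inside))
  combine∈block {suc q} (suc k) i = Vec.lookup⇒[]= _ _
    (trans (Vec.lookup-++ʳ (Subset.⊥ {L}) _ (combine k i)) (Vec.[]=⇒lookup (combine∈block k i)))

  -- Disjointness of the blocks. When exactly one of the two indices is `zero`, the entry looked up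
  -- lies in a `Subset.⊥` part.
  combine∈block⇒≡ : ∀ {q} (k l : Fin q) (i : Fin L) → combine l i Subset.∈ block k → l ≡ k
  combine∈block⇒≡ {suc q} zero    zero    i _ = refl
  combine∈block⇒≡ {suc q} zero    (suc l) i h = contradiction
    (Vec.lookup⇒[]= _ _ (trans (sym (Vec.lookup-++ʳ (Subset.⊤ {L}) _ (combine l i))) (Vec.[]=⇒lookup h)))
    (∉⊥ {x = combine l i})
  combine∈block⇒≡ {suc q} (suc k) zero    i h = contradiction
    (Vec.lookup⇒[]= _ _ (trans (sym (Vec.lookup-++ˡ (Subset.⊥ {L}) (block k) i)) (Vec.[]=⇒lookup h)))
    (∉⊥ {x = i})
  combine∈block⇒≡ {suc q} (suc k) (suc l) i h = cong suc (combine∈block⇒≡ k l i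
    (Vec.lookup⇒[]= _ _ (trans (sym (Vec.lookup-++ʳ (Subset.⊥ {L}) _ (combine l i))) (Vec.[]=⇒lookup h))))

  blockCorpus : ∀ q → Corpus (q * L) q
  blockCorpus q = Vec.tabulate block

  blockCorpus-atMost : ∀ q → AtMost L WordsPerDocument (blockCorpus q)
  blockCorpus-atMost q = tabulate⁺ (λ k → ℕ.≤-reflexive (∣block∣ k))

  #₁-blockCorpus : ∀ {q} (k : Fin q) i → #₁ (blockCorpus q) (combine k i) ≡ 1
  #₁-blockCorpus k i = count-tabulate-unique _ block k (combine∈block k i)
    (λ l → combine∈block⇒≡ l k i)

  #₂-blockCorpus : ∀ {q} (k : Fin q) i j → #₂ (blockCorpus q) (combine k i) (combine k j) ≡ 1
  #₂-blockCorpus k i j = count-tabulate-unique _ block k (combine∈block k i , combine∈block k j)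
    (λ l → combine∈block⇒≡ l k i ∘ proj₁)

  blockPairs : ∀ q → List (Word (q * L) × Word (q * L))
  blockPairs q = cartesianProductWith (λ k (i , j) → combine k i , combine k j) (allFin q) (increasingPairs L)

  length-blockPairs : ∀ q → length (blockPairs q) ≡ q * (L C 2)
  length-blockPairs q = trans (length-cartesianProductWith _ (allFin q) (increasingPairs L))
    (cong₂ _*_ (List.length-tabulate {n = q} (λ i → i)) (length-increasingPairs L))

  blockPairs-unique : ∀ q → Unique (blockPairs q)
  blockPairs-unique q = Unique.cartesianProductWith⁺ _ injective (Unique.allFin⁺ q) (increasingPairs-unique L)
    where
    injective : ∀ {k l : Fin q} {ij ij′ : Fin L × Fin L} →
      (combine k (proj₁ ij) , combine k (proj₂ ij)) ≡ (combine l (proj₁ ij′) , combine l (proj₂ ij′)) →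
      k ≡ l × ij ≡ ij′
    injective {k} {l} {i , j} {i′ , j′} eq =
      let k≡l , i≡i′ = Fin.combine-injective k i l i′ (cong proj₁ eq)
      in k≡l , cong₂ _,_ i≡i′ (Fin.combine-injectiveʳ k j l j′ (cong proj₂ eq))

  All-blockPairs : ∀ q {P : Word (q * L) × Word (q * L) → Set} →
    (∀ k i j → i < j → P (combine k i , combine k j)) → All P (blockPairs q)
  All-blockPairs q h = All.cartesianProductWith⁺ (setoid _) (setoid _) _ (allFin q) (increasingPairs L)
    (λ {k} _ ij∈ → h k _ _ (All.lookup (increasingPairs-< L) ij∈))

  blockPairs-< : ∀ q → All (λ (x , y) → x < y) (blockPairs q)
  -- `combine k i` has value `L * k + i`, so within a block the order is that of `i`.
  blockPairs-< q = All-blockPairs q λ k i j i<j → subst₂ ℕ._<_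
    (sym (Fin.toℕ-combine k i)) (sym (Fin.toℕ-combine k j)) (ℕ.+-monoʳ-< (L * Fin.toℕ k) i<j)

  -- Each word of a block occurs in one document only, so all three counts are 1.
  cosine-blockCorpus : ∀ {q} (k : Fin q) i j n →
    seq (cosine (blockCorpus q) (combine k i) (combine k j)) n ≡ 1ℚ
  cosine-blockCorpus k i j n = cong₂ ℚ._*_ (cong ι (#₂-blockCorpus k i j))
    (cong₂ ℚ._*_ (trans (cong (λ m → seq (1/√ m) n) (#₁-blockCorpus k i)) (1/√1 n))
                 (trans (cong (λ m → seq (1/√ m) n) (#₁-blockCorpus k j)) (1/√1 n)))

  cosine-blockPairs-≈1 : ∀ q → All (λ (x , y) → cosine (blockCorpus q) x y ≈ᵣ 1ᵣ) (blockPairs q)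
  cosine-blockPairs-≈1 q = All-blockPairs q λ k i j _ η η>0 → 0 , λ n _ →
    ℚ.≤-trans (ℚ.≤-reflexive (cong (λ c → ℚ.∣ c ℚ.- 1ℚ ∣) (cosine-blockCorpus k i j n))) (ℚ.<⇒≤ η>0)

  cosine-blockPairs-≥ : ∀ q ε → ε ≤ᵣ 1ᵣ → All (λ (x , y) → ε ≤ᵣ cosine (blockCorpus q) x y) (blockPairs q)
  cosine-blockPairs-≥ q ε ε≤1 = All-blockPairs q λ k i j _ η η>0 →
    let N , h = ε≤1 η η>0
    in N , λ n N≤n → subst (λ c → seq ε n ℚ.≤ c ℚ.+ η) (sym (cosine-blockCorpus k i j n)) (h n N≤n)

  -- Stated for an arbitrary list, so that it applies both to the output of an algorithm and to the
  -- keys of a shuffle.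
  blockCorpus-output-size : ∀ q ε → ε ≤ᵣ 1ᵣ → ∀ out →
    ContainsAllSimilarPairs ε (blockCorpus q) out → q * (L C 2) ≤ length out
  blockCorpus-output-size q ε ε≤1 out contains =
    ℕ.≤-trans (ℕ.≤-reflexive (sym (length-blockPairs q)))
      (unordered-⊆⇒length-≤ (blockPairs-unique q) (blockPairs-< q) λ {x} {y} xy∈ →
        contains x y (Fin.<⇒≢ (All.lookup (blockPairs-< q) xy∈))
          (All.lookup (cosine-blockPairs-≥ q ε ε≤1) xy∈))

theorem2 :
    (∃[ K ] ∀ (D L N : ℕ) (T : Corpus D N) (ε : ℝ) (ε>0 : 0ᵣ <ᵣ ε) →
      2 ≤ D → AtMost L WordsPerDocument T → ε ≤ᵣ 1ᵣ →
      let p = fromℕ 2 *ᵣ log D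
          shuffle = CosineSampleEmit.shuffle p ε ε>0 T
          bound = (p *ᵣ ε ⁻¹⟨ ε>0 ⟩) *ᵣ fromℕ L *ᵣ fromℕ D
      in 𝔼 shuffle (λ out → fromℕ (length out)) ≤ᵣ bound
         × bound ≤ᵣ fromℕ K *ᵣ (fromℕ D *ᵣ fromℕ L *ᵣ log D *ᵣ ε ⁻¹⟨ ε>0 ⟩))
    ×
    (∃[ K ] ∀ (D L : ℕ) → 2 ≤ D → 2 ≤ L → (L∣D : L ∣ D) →
      let numPairs = quotient L∣D * (L C 2)
      in D * L ≤ K * numPairs
         × (∃[ N ] Σ[ T ∈ Corpus D N ] AtMost L WordsPerDocument T
             × (Σ[ ps ∈ List (Word D × Word D) ] Unique ps
                 × All (λ (x , y) → x < y) ps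
                 × numPairs ≤ length ps
                 × All (λ (x , y) → cosine T x y ≈ᵣ 1ᵣ) ps
                 × (∀ ε → 0ᵣ <ᵣ ε → ε ≤ᵣ 1ᵣ → All (λ (x , y) → ε ≤ᵣ cosine T x y) ps))
             × (∀ ε → (ε>0 : 0ᵣ <ᵣ ε) → ε ≤ᵣ 1ᵣ →
                 (∀ (alg : Algorithm D) → OutputsAllSimilarPairs L ε alg →
                   numPairs ≤ length (alg T) × D * L ≤ K * length (alg T))
                 × (∀ out →
                     out ∈ outcomes (CosineSampleEmit.shuffle (fromℕ 2 *ᵣ log D) ε ε>0 T) →
                     ContainsAllSimilarPairs ε T (map proj₁ out) →
                     numPairs ≤ length out × D * L ≤ K * length out))))
theorem2 = (2 , λ D L N T ε ε>0 _ atMost _ →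
      expected-shuffle-size T (fromℕ 2 *ᵣ log D) ε ε>0 (0≤2log D) atMost ,
      bound-rearranged D L (log D) (ε ⁻¹⟨ ε>0 ⟩))
  -- Matching on the divisibility witness turns `D` into `q * L`, the index type of the block
  -- corpus. The constant 4 is that of `q*L*L≤4*[q*LC2]`.
  , (4 , λ { .(q * L) L _ 2≤L (divides q refl) →
      q*L*L≤4*[q*LC2] q L 2≤L ,
      q , blockCorpus L q , blockCorpus-atMost L q ,
      (blockPairs L q , blockPairs-unique L q , blockPairs-< L q ,
        ℕ.≤-reflexive (sym (length-blockPairs L q)) , cosine-blockPairs-≈1 L q ,
        λ ε _ → cosine-blockPairs-≥ L q ε) ,
      λ ε _ ε≤1 →
        (λ alg correct → both q L 2≤L (blockCorpus-output-size L q ε ε≤1 (alg (blockCorpus L q))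
          (correct (blockCorpus L q) (blockCorpus-atMost L q)))) ,
        -- The bound is applied to the list of keys, which is as long as the emitted list.
        (λ out _ contains → both q L 2≤L
          (ℕ.≤-trans (blockCorpus-output-size L q ε ε≤1 (map proj₁ out) contains)
                     (ℕ.≤-reflexive (List.length-map proj₁ out)))) })
  where
  both : ∀ q L {n} → 2 ≤ L → q * (L C 2) ≤ n → q * (L C 2) ≤ n × q * L * L ≤ 4 * n
  both q L 2≤L h = h , ℕ.≤-trans (q*L*L≤4*[q*LC2] q L 2≤L) (ℕ.*-monoʳ-≤ 4 h)
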